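{- Every nonshellable $2$-dimensional simplicial complex has a nonshellable induced subcomplex with $n$ vertices for some $n$ with $4\le n\le 7$.
   Context: All simplicial complexes are finite (abstract) and contain the empty face; if $K$ is a simplicial complex on vertex set $V$, then $\{v\}\in K$ for every $v\in V$. Facets are the inclusion-maximal faces; $\dim F=|F|-1$. A complex is pure if all its facets have the same dimension. For $U\subseteq V$, the induced subcomplex $K(U)$ is $\{F\in K: F\subseteq U\}$ (possibly $U=V$). Shellability means (not necessarily pure) shellability: $K$ is shellable if its facets can be ordered $F_1,\dots,F_t$ so that for each $k=2,\dots,t$ the complex $\left(\bigcup_{i=1}^{k-1}\bar F_i\right)\cap \bar F_k$ is pure of dimension $\dim F_k-1$, where $\bar F$ denotes the simplex consisting of all subsets of $F$. -}

module Defs where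

open import Data.Fin using (Fin; toℕ)
import Data.Fin as Fin
open import Data.Fin.Subset using (Subset; ⊥; ⁅_⁆; _∈_; _⊆_; ∣_∣)
open import Data.Fin.Subset.Properties using (_⊆?_; ⊥⊆; ⊆-trans; x∈⁅y⁆⇒x≡y)
open import Data.Integer using (ℤ; +_; _-_; _≤_; 1ℤ)
open import Data.Nat using (ℕ)
import Data.Nat as ℕ
open import Data.Product using (∃-syntax; _×_; _,_)
open import Function.Bundles using (_⇔_)
open import Function.Definitions using (Injective)
open import Level using (0ℓ)
open import Relation.Binary.PropositionalEquality using (_≡_; sym; subst)
open import Relation.Nullary.Decidable using (_×-dec_)
open import Relation.Unary using (Pred; Decidable; _∩_)

-- Vertex sets are subsets of an ambient Fin m rather than all of Fin m, so
-- that an induced subcomplex is again a complex over the same ambient set.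
-- Decidability of Face expresses that the faces form a finite family.
record SimplicialComplex (m : ℕ) : Set₁ where
  field
    vertices      : Subset m
    Face          : Pred (Subset m) 0ℓ
    face?         : Decidable Face
    face⊆vertices : ∀ {F} → Face F → F ⊆ vertices
    ⊥-face        : Face ⊥
    ⊆-closed      : ∀ {F G} → G ⊆ F → Face F → Face G
    vertex-face   : ∀ {v} → v ∈ vertices → Face ⁅ v ⁆

open SimplicialComplex public

induced : ∀ {m} (K : SimplicialComplex m) (U : Subset m) →
          U ⊆ vertices K → SimplicialComplex m
induced K U U⊆V = record
  { vertices      = U
  ; Face          = λ F → Face K F × F ⊆ U
  ; face?         = λ F → face? K F ×-dec (F ⊆? U)
  ; face⊆vertices = λ (_ , F⊆U) → F⊆U
  ; ⊥-face        = ⊥-face K , ⊥⊆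
  ; ⊆-closed      = λ G⊆F (F∈K , F⊆U) → ⊆-closed K G⊆F F∈K , ⊆-trans G⊆F F⊆U
  ; vertex-face   = λ v∈U → vertex-face K (U⊆V v∈U) ,
                            λ x∈⁅v⁆ → subst (_∈ U) (sym (x∈⁅y⁆⇒x≡y _ x∈⁅v⁆)) v∈U
  }

dim : ∀ {m} → Subset m → ℤ
dim F = + ∣ F ∣ - 1ℤ

-- Facets, dimension and purity depend only on the family of faces, so they are
-- defined for families; this covers the intersections occurring in a shelling.
Family : ℕ → Set₁
Family m = Pred (Subset m) 0ℓ

IsFacet : ∀ {m} → Family m → Subset m → Set
IsFacet 𝓕 F = 𝓕 F × (∀ G → 𝓕 G → F ⊆ G → F ≡ G)

HasDimension : ∀ {m} → Family m → ℤ → Set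
HasDimension 𝓕 d = (∃[ F ] 𝓕 F × dim F ≡ d) × (∀ F → 𝓕 F → dim F ≤ d)

IsPure : ∀ {m} → Family m → Set
IsPure 𝓕 = ∀ F G → IsFacet 𝓕 F → IsFacet 𝓕 G → dim F ≡ dim G

simplex : ∀ {m} → Subset m → Family m
simplex F G = G ⊆ F

earlier : ∀ {m t} → (Fin t → Subset m) → Fin t → Family m
earlier F k G = ∃[ i ] i Fin.< k × simplex (F i) G

-- Indices start at 0, so the condition on the second and later facets is
-- imposed for 0 < toℕ k.
record Shellable {m} (K : SimplicialComplex m) : Set where
  field
    t         : ℕ
    facet     : Fin t → Subset m
    injective : Injective _≡_ _≡_ facet
    facets    : ∀ F → IsFacet (Face K) F ⇔ (∃[ k ] facet k ≡ F)
    shelling  : ∀ k → 0 ℕ.< toℕ k →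
                let 𝓘 = earlier facet k ∩ simplex (facet k) in
                IsPure 𝓘 × HasDimension 𝓘 (dim (facet k) - 1ℤ)

{-# OPTIONS --safe #-}
module Submission where

-- Write T for the 3-uniform hypergraph of triangles of K and E for the graph of edges of triangles.  A shelling of
-- T forces T and all vertex links to be connected and every Z/2-valued 1-cocycle on E to be a coboundary; if all
-- induced subcomplexes on four to seven vertices are shellable, these properties hold locally.  Disjoint triangles
-- are then joined by a triangle in their union, links contain no two disjoint edges without an edge between them,
-- and it follows that every 1-cocycle of T vanishes on all closed walks of length at most five: such a walk and the
-- apexes of its edges can be cut down to configurations of at most seven vertices.
--
-- Now shell T by adding one vertex v at a time, ordering the triangles v * e by edges e of the link of v.  This
-- works once the link edges lying in the deletion of v connect all link vertices in the deletion.  If they did not,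
-- a cut between their components would define a cocycle that is nonzero on a closed walk v, a, u, w, b through the
-- star of v and the deletion, where any two vertices are at distance at most three.  Finally, the facets of
-- dimension at most one can be appended because the graph of K contains no induced pair of disjoint edges.

open import Data.Bool using (Bool; true; false; _xor_)
import Data.Bool.Properties as Bool
open import Data.Fin using (Fin; toℕ; combine; remQuot; opposite)
import Data.Fin as Fin
import Data.Fin.Properties as Fin
open import Data.Fin.Subset using (Subset; ⁅_⁆; _∈_; _∉_; _⊆_; _∪_; _∩_; _-_; ∣_∣; ⊥; inside; outside)
open import Data.Fin.Subset.Properties
open import Data.Integer using (+_; 1ℤ)
import Data.Integer as ℤ
import Data.Integer.Properties as ℤ
open import Data.List using (List; []; _∷_; length; map; _++_; filter; foldr)
import Data.List as List
open import Data.List.Membership.Propositional using (find; lose) renaming (_∈_ to _∈ˡ_; _∉_ to _∉ˡ_)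
open import Data.List.Membership.Propositional.Properties
  using (∈-map⁺; ∈-++⁺ˡ; ∈-++⁺ʳ; ∈-filter⁺; ∈-lookup)
open import Data.List.Properties using (filter-notAll)
open import Data.List.Relation.Unary.All using (All; []; _∷_)
import Data.List.Relation.Unary.All as All
open import Data.List.Relation.Unary.All.Properties using (¬Any⇒All¬)
open import Data.List.Relation.Unary.AllPairs using ([]; _∷_)
open import Data.List.Relation.Unary.Any using (here; there)
import Data.List.Relation.Unary.Any as Any
open import Data.List.Relation.Unary.Any.Properties using (lookup-index)
open import Data.List.Relation.Unary.Unique.Propositional using (Unique)
open import Data.Nat using (ℕ; zero; suc; _+_; _*_; _∸_; _≤_; _<_; z≤n; s≤s)
import Data.Nat.Properties as ℕ
open import Data.Product using (∃; ∃-syntax; Σ-syntax; _×_; _,_; proj₁; proj₂; uncurry)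
open import Data.Sum using (_⊎_; inj₁; inj₂)
open import Data.Unit using () renaming (⊤ to Unit)
open import Data.Vec using ([]; _∷_; lookup; tabulate)
import Data.Vec.Properties as Vec
open import Function using (_∘_)
open import Function.Bundles using (Equivalence; mk⇔)
open import Relation.Binary.Definitions using (tri<; tri≈; tri>)
open import Relation.Binary.PropositionalEquality
open import Relation.Nullary using (¬_; Dec; yes; no; does; contradiction; ⌊_⌋)
open import Relation.Nullary.Decidable
  using (_→-dec_; _×-dec_; _⊎-dec_; ¬?; map′; decidable-stable; toWitness; dec-true; dec-false)
open import Defs

-- The bound seven comes from quadrilaterals: four vertices and four apexes make eight, so the
-- hypothesis speaks about a closed walk of length four once two of its edges share an apex. All
-- other walks have to be cut until such a configuration, or a triangle with its three apexes, is
-- left; the tool is the triangle that joins the triangles on two disjoint edges. The bound four is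
-- the size of a pair of disjoint edges. The connectivity asked of the link is forced by attachment:
-- if `vxy` were added along `vx` alone while `y` already lies in the deletion of `v`, it would meet
-- the earlier triangles in an edge and an isolated point. The cocycle of a cut is the
-- Mayer-Vietoris connecting map for star and deletion, applied to a separation of their
-- intersection. The local conditions are decidable, so a subcomplex violating them can be found by
-- search, and the violation refutes its shellability.

∀-Bool? : {P : Bool → Set} → (∀ b → Dec (P b)) → Dec (∀ b → P b)
∀-Bool? P? = map′ (λ (p , q) → λ { true → p ; false → q }) (λ p → p true , p false)
                  (P? true ×-dec P? false)

pattern 0th = here refl
pattern 1st = there 0th
pattern 2nd = there 1st
pattern 3rd = there 2nd
pattern 4th = there 3rd
pattern 5th = there 4th
pattern 6th = there 5th

-- Arithmetic in Z/2

infixr 6 _⊕_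

-- Opaque so that unification can read off the summands of a ⊕ b.
opaque
  _⊕_ : Bool → Bool → Bool
  _⊕_ = _xor_

  ⊕-telescope : ∀ a b c → (a ⊕ b) ⊕ (b ⊕ c) ≡ a ⊕ c
  ⊕-telescope = toWitness {a? = ∀-Bool? λ a → ∀-Bool? λ b → ∀-Bool? λ c → _ Bool.≟ _} _

  ⊕-self : ∀ a → a ⊕ a ≡ false
  ⊕-self = Bool.xor-same

  ⊕-quadrilateral : ∀ a b c d → a ⊕ b ≡ c ⊕ d → b ⊕ d ≡ a ⊕ c
  ⊕-quadrilateral = toWitness {a? = ∀-Bool? λ a → ∀-Bool? λ b → ∀-Bool? λ c → ∀-Bool? λ d →
                                    (_ Bool.≟ _) →-dec (_ Bool.≟ _)} _

  ⊕-spin : ∀ a b c d e → b ⊕ (c ⊕ (d ⊕ (e ⊕ a))) ≡ false → a ⊕ (b ⊕ (c ⊕ (d ⊕ e))) ≡ false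
  ⊕-spin = toWitness {a? = ∀-Bool? λ a → ∀-Bool? λ b → ∀-Bool? λ c → ∀-Bool? λ d → ∀-Bool? λ e →
    (_ Bool.≟ _) →-dec (_ Bool.≟ _)} _

  ⊕-reflect : ∀ a b c d e → d ⊕ (c ⊕ (b ⊕ (a ⊕ e))) ≡ false → a ⊕ (b ⊕ (c ⊕ (d ⊕ e))) ≡ false
  ⊕-reflect = toWitness {a? = ∀-Bool? λ a → ∀-Bool? λ b → ∀-Bool? λ c → ∀-Bool? λ d → ∀-Bool? λ e →
    (_ Bool.≟ _) →-dec (_ Bool.≟ _)} _

  ⊕-chord : ∀ a b c d e → (a ⊕ b) ⊕ c ≡ e ⊕ d → a ⊕ (b ⊕ (c ⊕ (d ⊕ e))) ≡ false
  ⊕-chord = toWitness {a? = ∀-Bool? λ a → ∀-Bool? λ b → ∀-Bool? λ c → ∀-Bool? λ d → ∀-Bool? λ e →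
    (_ Bool.≟ _) →-dec (_ Bool.≟ _)} _

  ⊕-hub : ∀ a b c d e p q → b ⊕ c ≡ p ⊕ q → a ⊕ e ≡ p ⊕ (q ⊕ d) →
    a ⊕ (b ⊕ (c ⊕ (d ⊕ e))) ≡ false
  ⊕-hub = toWitness {a? = ∀-Bool? λ a → ∀-Bool? λ b → ∀-Bool? λ c → ∀-Bool? λ d → ∀-Bool? λ e → ∀-Bool? λ p → ∀-Bool? λ q →
    (_ Bool.≟ _) →-dec (_ Bool.≟ _) →-dec (_ Bool.≟ _)} _

  ⊕-replace : ∀ a b a′ b′ c → a ⊕ b ≡ a′ ⊕ b′ → a′ ⊕ (b′ ⊕ c) ≡ false → a ⊕ (b ⊕ c) ≡ false
  ⊕-replace = toWitness {a? = ∀-Bool? λ a → ∀-Bool? λ b → ∀-Bool? λ a′ → ∀-Bool? λ b′ → ∀-Bool? λ c →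
    (_ Bool.≟ _) →-dec (_ Bool.≟ _) →-dec (_ Bool.≟ _)} _

  ⊕-identityˡ : ∀ a → false ⊕ a ≡ a
  ⊕-identityˡ = toWitness {a? = ∀-Bool? λ a →
    (_ Bool.≟ _)} _

  ⊕-identityʳ : ∀ a → a ⊕ false ≡ a
  ⊕-identityʳ = Bool.xor-identityʳ

  ⊕-comm : ∀ a b → a ⊕ b ≡ b ⊕ a
  ⊕-comm = Bool.xor-comm

  ⊕-cancelˡ : ∀ a b → a ⊕ (a ⊕ b) ≡ b
  ⊕-cancelˡ = toWitness {a? = ∀-Bool? λ a → ∀-Bool? λ b → _ Bool.≟ _} _

  ⊕-cancelʳ : ∀ a b → (a ⊕ b) ⊕ b ≡ a
  ⊕-cancelʳ = toWitness {a? = ∀-Bool? λ a → ∀-Bool? λ b → _ Bool.≟ _} _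

  ⊕-ends : ∀ a b → a ⊕ (false ⊕ (false ⊕ (false ⊕ b))) ≡ false → a ≡ b
  ⊕-ends = toWitness {a? = ∀-Bool? λ a → ∀-Bool? λ b → (_ Bool.≟ _) →-dec (_ Bool.≟ _)} _

-- Closed walks and cocycles

record TripleSystem (V : Set) : Set₁ where
  field
    T        : V → V → V → Set
    T?       : ∀ x y z → Dec (T x y z)
    T-swap   : ∀ {x y z} → T x y z → T y x z
    T-rotate : ∀ {x y z} → T x y z → T y z x
    T⇒≢      : ∀ {x y z} → T x y z → x ≢ y

  E : V → V → Set
  E x y = ∃[ z ] T x y z

  Split : V → V → V → V → Set
  Split a b c w = T a b w ⊎ T a c w ⊎ T b c w

  -- Two disjoint triangles are joined by a triangle with two vertices in one of them and one in the
  -- other; here `abc` contributes two.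
  Half : V → V → V → V → V → V → Set
  Half a b c d e f = Split a b c d ⊎ Split a b c e ⊎ Split a b c f

  _∈[_,_,_] : V → V → V → V → Set
  x ∈[ a , b , c ] = x ≡ a ⊎ x ≡ b ⊎ x ≡ c

  Cross : V → V → V → V → V → V → Set
  Cross a b c d e f = (∃[ u ] u ∈[ a , b , c ] × u ∈[ d , e , f ]) ⊎ Half a b c d e f ⊎ Half d e f a b c

  Link : V → V → V → V → V → Set
  Link v a b c d = (a ≡ c ⊎ a ≡ d ⊎ b ≡ c ⊎ b ≡ d) ⊎ (T v a c ⊎ T v a d ⊎ T v b c ⊎ T v b d)

  Within : List V → V → V → V → Set
  Within us x y z = x ∈ˡ us × y ∈ˡ us × z ∈ˡ us × T x y z

  Cocycle : (V → V → V → Set) → (V → V → Bool) → Set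
  Cocycle R φ = ∀ {x y z} → R x y z → φ x y ⊕ φ y z ≡ φ x z

record Hereditary {V : Set} (𝓣 : TripleSystem V) : Set₁ where
  open TripleSystem 𝓣
  field
    cross : ∀ {a b c d e f} → T a b c → T d e f → Cross a b c d e f
    link  : ∀ {v a b c d} → T v a b → T v c d → Link v a b c d
    -- Four distinct vertices and at most three more keep the subcomplex between four and seven
    -- vertices. Lying on an edge places each of them in the vertex set of the system at hand, which
    -- may be smaller than that of the whole complex.
    local : ∀ φ → Cocycle T φ → ∀ {a b c d us} → Unique (a ∷ b ∷ c ∷ d ∷ []) → length us ≤ 3 →
            All (λ u → ∃ (E u)) (a ∷ b ∷ c ∷ d ∷ us) →
            Σ[ f ∈ (V → Bool) ] (∀ {x y z} → Within (a ∷ b ∷ c ∷ d ∷ us) x y z → φ x y ≡ f x ⊕ f y)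

module Cohomology {V : Set} (_≟_ : ∀ (x y : V) → Dec (x ≡ y))
                  (𝓣 : TripleSystem V) (hereditary : Hereditary 𝓣) where
  open TripleSystem 𝓣
  open Hereditary hereditary

  T-flip : ∀ {x y z} → T x y z → T x z y
  T-flip = T-swap ∘ T-rotate ∘ T-rotate

  E₁₂ : ∀ {x y z} → T x y z → E x y
  E₁₂ t = _ , t

  E₁₃ : ∀ {x y z} → T x y z → E x z
  E₁₃ t = _ , T-flip t

  E₂₃ : ∀ {x y z} → T x y z → E y z
  E₂₃ t = _ , T-rotate t

  E-sym : ∀ {x y} → E x y → E y x
  E-sym (_ , t) = _ , T-swap t

  E⇒≢ : ∀ {x y} → E x y → x ≢ y
  E⇒≢ (_ , t) = T⇒≢ t

  -- A chord may degenerate to a coincidence of the two vertices.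
  Chord : V → V → Set
  Chord x y = x ≡ y ⊎ E x y

  module Closed (E? : ∀ x y → Dec (E x y)) (φ : V → V → Bool) (φ-sym : ∀ x y → φ x y ≡ φ y x) (cocycle : Cocycle T φ) where

    chord? : ∀ x y → Dec (Chord x y)
    chord? x y = (x ≟ y) ⊎-dec E? x y

    Closed₄ : V → V → V → V → Set
    Closed₄ w x y z = φ w x ⊕ φ x y ≡ φ w z ⊕ φ z y

    Pentagon : V → V → V → V → V → Set
    Pentagon a b c d e = E a b × E b c × E c d × E d e × E e a

    turn : ∀ {a b c d e} → Pentagon a b c d e → Pentagon b c d e a
    turn (ab , bc , cd , de , ea) = bc , cd , de , ea , ab

    Closed₅ : V → V → V → V → V → Set
    Closed₅ a b c d e = φ a b ⊕ (φ b c ⊕ (φ c d ⊕ (φ d e ⊕ φ e a))) ≡ false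

    -- The three edges and their apexes span at most six vertices, on which `φ` is a coboundary. If
    -- `xyz` is not itself a triangle, then `z` differs from `p`, so four of the vertices are
    -- distinct.
    triangle : ∀ {x y z} → E x y → E y z → E x z → φ x y ⊕ φ y z ≡ φ x z
    triangle {x} {y} {z} (p , tp) (q , tq) (r , tr) with T? x y z
    ... | yes t = cocycle t
    ... | no ¬t = let f , eq = potential in
      trans (cong₂ _⊕_ (eq (0th , 1st , 3rd , tp)) (eq (1st , 2nd , 4th , tq)))
            (trans (⊕-telescope (f x) (f y) (f z)) (sym (eq (0th , 2nd , 5th , tr))))
      where
      potential = local φ cocycle {x} {y} {z} {p} {q ∷ r ∷ []}
        ((T⇒≢ tp ∷ T⇒≢ tr ∷ T⇒≢ (T-flip tp) ∷ []) ∷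
         (T⇒≢ tq ∷ T⇒≢ (T-rotate tp) ∷ []) ∷
         ((λ { refl → ¬t tp }) ∷ []) ∷ [] ∷ [])
        (s≤s (s≤s z≤n))
        ((_ , E₁₂ tp) ∷ (_ , E₁₂ tq) ∷ (_ , E-sym (E₁₂ tr)) ∷ (_ , E-sym (E₁₃ tp)) ∷
         (_ , E-sym (E₁₃ tq)) ∷ (_ , E-sym (E₁₃ tr)) ∷ [])

    bypass : ∀ {x y z u} → E x y → E y z → E u x → E u y → E u z →
             φ x y ⊕ φ y z ≡ φ x u ⊕ φ u z
    bypass {x} {y} {z} {u} xy yz ux uy uz =
      trans (cong₂ _⊕_ (sym (triangle (E-sym ux) uy xy)) (sym (triangle (E-sym uy) uz yz)))
            (subst (λ b → (φ x u ⊕ φ u y) ⊕ (b ⊕ φ u z) ≡ φ x u ⊕ φ u z) (φ-sym u y) (⊕-telescope _ _ _))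

    -- Closed walks of length four

    closed₄-swap : ∀ {w x y z} → Closed₄ w x y z → Closed₄ x y z w
    closed₄-swap {w} {x} {y} {z} p rewrite φ-sym x w | φ-sym y z = ⊕-quadrilateral _ _ _ _ p

    closed₄-flip : ∀ {w x y z} → Closed₄ w x y z → Closed₄ x w z y
    closed₄-flip {w} {x} {y} {z} p rewrite φ-sym x w | φ-sym y z = sym (⊕-quadrilateral _ _ _ _ p)

    -- An apex shared by two consecutive edges leaves only seven vertices in all.
    quadrilateral-shared : ∀ {w x y z p} → w ≢ y → x ≢ z → T w x p → T x y p → E y z → E z w → Closed₄ w x y z
    quadrilateral-shared {w} {x} {y} {z} {p} w≢y x≢z wxp xyp (q , yzq) (r , zwr) =
      trans (cong₂ _⊕_ (eq (0th , 1st , 4th , wxp)) (eq (1st , 2nd , 4th , xyp)))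
        (trans (⊕-telescope (f w) (f x) (f y))
          (sym (trans (cong₂ _⊕_ (eq (0th , 3rd , 6th , T-swap zwr)) (eq (3rd , 2nd , 5th , T-swap yzq)))
                      (⊕-telescope (f w) (f z) (f y)))))
      where
      potential = local φ cocycle {w} {x} {y} {z} {p ∷ q ∷ r ∷ []}
        ((T⇒≢ wxp ∷ w≢y ∷ T⇒≢ (T-swap zwr) ∷ []) ∷ (T⇒≢ xyp ∷ x≢z ∷ []) ∷ (T⇒≢ yzq ∷ []) ∷ [] ∷ [])
        (s≤s (s≤s (s≤s z≤n)))
        ((_ , E₁₂ wxp) ∷ (_ , E₁₂ xyp) ∷ (_ , E₁₂ yzq) ∷ (_ , E₁₂ zwr) ∷
         (_ , E-sym (E₁₃ wxp)) ∷ (_ , E-sym (E₁₃ yzq)) ∷ (_ , E-sym (E₁₃ zwr)) ∷ [])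
      f  = proj₁ potential
      eq : ∀ {a b c} → Within (w ∷ x ∷ y ∷ z ∷ p ∷ q ∷ r ∷ []) a b c → φ a b ≡ f a ⊕ f b
      eq = proj₂ potential

    quadrilateral-centre : ∀ {w x y z u} → E w x → E x y → E y z → E z w →
                           E u w → E u x → E u y → E u z → Closed₄ w x y z
    quadrilateral-centre wx xy yz zw uw ux uy uz =
      trans (bypass wx xy uw ux uy) (sym (bypass (E-sym zw) (E-sym yz) uw uz uy))

    quadrilateral-chord : ∀ {w x y z} → E w x → E x y → E y z → E z w → Chord w y → Closed₄ w x y z
    quadrilateral-chord {w} {x} {y} {z} _ _ _ _ (inj₁ refl) rewrite φ-sym x w | φ-sym z w =
      trans (⊕-self _) (sym (⊕-self _))
    quadrilateral-chord wx xy yz zw (inj₂ wy) =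
      trans (triangle wx xy wy) (sym (triangle (E-sym zw) (E-sym yz) wy))

    -- Without diagonals, the joining triangle makes `p` an apex of two consecutive edges, makes `q`
    -- adjacent to all four vertices, or contains `p` and `q`. In the last case moving `z` or `y` to
    -- `q` produces the shared apex.
    quadrilateral-half : ∀ {w x y z p q} → ¬ Chord w y → ¬ Chord x z → T w x p → T y z q → E x y → E z w →
                         Half w x p y z q → Closed₄ w x y z
    quadrilateral-half {w} {x} {y} {z} {p} {q} ¬wy ¬xz wxp yzq xy zw = λ where
        (inj₁ (inj₁ wxy))               → contradiction (inj₂ (E₁₃ wxy)) ¬wy
        (inj₁ (inj₂ (inj₁ wpy)))        → contradiction (inj₂ (E₁₃ wpy)) ¬wy
        (inj₁ (inj₂ (inj₂ xpy)))        → quadrilateral-shared w≢y x≢z wxp (T-flip xpy) (E₁₂ yzq) zw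
        (inj₂ (inj₁ (inj₁ wxz)))        → contradiction (inj₂ (E₂₃ wxz)) ¬xz
        (inj₂ (inj₁ (inj₂ (inj₁ wpz)))) → closed₄-swap
          (quadrilateral-shared (x≢z ∘ sym) w≢y (T-swap (T-flip wpz)) wxp xy (E₁₂ yzq))
        (inj₂ (inj₁ (inj₂ (inj₂ xpz)))) → contradiction (inj₂ (E₁₃ xpz)) ¬xz
        (inj₂ (inj₂ (inj₁ wxq)))        → quadrilateral-centre (E₁₂ wxp) xy (E₁₂ yzq) zw
          (E-sym (E₁₃ wxq)) (E-sym (E₂₃ wxq)) (E-sym (E₁₃ yzq)) (E-sym (E₂₃ yzq))
        (inj₂ (inj₂ (inj₂ (inj₁ wpq)))) → detour wxp yzq xy zw w≢y
          (λ { refl → ¬xz (inj₂ (E-sym (E₂₃ yzq))) }) wpq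
        (inj₂ (inj₂ (inj₂ (inj₂ xpq)))) → closed₄-flip
          (detour (T-swap wxp) (T-swap yzq) (E-sym zw) (E-sym xy) x≢z
            (λ { refl → ¬wy (inj₂ (E-sym (E₁₃ yzq))) }) xpq)
      where
      w≢y : w ≢ y
      w≢y = ¬wy ∘ inj₁
      x≢z : x ≢ z
      x≢z = ¬xz ∘ inj₁
      -- Replacing z by q gives a quadrilateral whose edges qw and wx share the apex p.
      detour : ∀ {w x y z p q} → T w x p → T y z q → E x y → E z w → w ≢ y → q ≢ x → T w p q →
                 Closed₄ w x y z
      detour wxp yzq xy zw w≢y q≢x wpq =
        trans (closed₄-swap (quadrilateral-shared q≢x w≢y (T-rotate (T-rotate (T-flip (T-flip wpq)))) wxp xy (E₁₃ yzq)))
              (sym (bypass (E-sym zw) (E-sym (E₁₂ yzq)) (E-sym (E₁₃ wpq)) (E-sym (E₂₃ yzq)) (E-sym (E₁₃ yzq))))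

    -- The triangles on the opposite edges `wx` and `yz` are compared. If there is no diagonal, they
    -- can meet only in a common apex, which is then a centre.
    quadrilateral : ∀ {w x y z} → E w x → E x y → E y z → E z w → Closed₄ w x y z
    quadrilateral {w} {x} {y} {z} wx@(p , wxp) xy yz@(q , yzq) zw with chord? w y | chord? x z
    ... | yes wy | _      = quadrilateral-chord wx xy yz zw wy
    ... | no _   | yes xz = closed₄-swap (closed₄-swap (closed₄-swap (quadrilateral-chord xy yz zw wx xz)))
    ... | no ¬wy | no ¬xz with cross wxp yzq
    ...   | inj₂ (inj₁ half) = quadrilateral-half ¬wy ¬xz wxp yzq xy zw half
    ...   | inj₂ (inj₂ half) = closed₄-swap (closed₄-swap
            (quadrilateral-half (¬wy ∘ λ { (inj₁ e) → inj₁ (sym e) ; (inj₂ e) → inj₂ (E-sym e) })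
                                (¬xz ∘ λ { (inj₁ e) → inj₁ (sym e) ; (inj₂ e) → inj₂ (E-sym e) }) yzq wxp zw xy half))
    ...   | inj₁ (_ , inj₁ refl        , inj₁ refl)        = contradiction (inj₁ refl) ¬wy
    ...   | inj₁ (_ , inj₁ refl        , inj₂ (inj₁ refl)) = contradiction refl (E⇒≢ zw)
    ...   | inj₁ (_ , inj₁ refl        , inj₂ (inj₂ refl)) = contradiction (inj₂ (E-sym (E₁₃ yzq))) ¬wy
    ...   | inj₁ (_ , inj₂ (inj₁ refl) , inj₁ refl)        = contradiction refl (E⇒≢ xy)
    ...   | inj₁ (_ , inj₂ (inj₁ refl) , inj₂ (inj₁ refl)) = contradiction (inj₁ refl) ¬xz
    ...   | inj₁ (_ , inj₂ (inj₁ refl) , inj₂ (inj₂ refl)) = contradiction (inj₂ (E-sym (E₂₃ yzq))) ¬xz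
    ...   | inj₁ (_ , inj₂ (inj₂ refl) , inj₁ refl)        = contradiction (inj₂ (E₁₃ wxp)) ¬wy
    ...   | inj₁ (_ , inj₂ (inj₂ refl) , inj₂ (inj₁ refl)) = contradiction (inj₂ (E₂₃ wxp)) ¬xz
    ...   | inj₁ (_ , inj₂ (inj₂ refl) , inj₂ (inj₂ refl)) =
            quadrilateral-centre wx xy yz zw (E-sym (E₁₃ wxp)) (E-sym (E₂₃ wxp)) (E-sym (E₁₃ yzq)) (E-sym (E₂₃ yzq))

    -- Closed walks of length five

    closed₅-spin : ∀ {a b c d e} → Closed₅ b c d e a → Closed₅ a b c d e
    closed₅-spin = ⊕-spin _ _ _ _ _

    closed₅-reflect : ∀ {a b c d e} → Closed₅ e d c b a → Closed₅ a b c d e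
    closed₅-reflect {a} {b} {c} {d} {e} p
      rewrite φ-sym a b | φ-sym b c | φ-sym c d | φ-sym d e | φ-sym e a = ⊕-reflect _ _ _ _ _ p

    pentagon-chord : ∀ {a b c d e} → Pentagon a b c d e → Chord a c → Closed₅ a b c d e
    pentagon-chord {a} {b} {c} {d} {e} (ab , bc , cd , de , ea) (inj₁ refl) rewrite φ-sym e a | φ-sym d e | φ-sym b a =
      ⊕-chord _ _ _ _ _ (trans (cong (_⊕ φ a d) (⊕-self _))
        (trans (⊕-identityˡ _) (sym (triangle (E-sym ea) (E-sym de) cd))))
    pentagon-chord {a} {b} {c} {d} {e} (ab , bc , cd , de , ea) (inj₂ ac) rewrite φ-sym e a | φ-sym d e =
      ⊕-chord _ _ _ _ _ (trans (cong (_⊕ φ c d) (triangle ab bc ac)) (quadrilateral ac cd de ea))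

    -- The hub cuts the walk into the quadrilaterals `bcdu` and `baeu` and the triangle `ude`.
    pentagon-hub : ∀ {a b c d e u} → Pentagon a b c d e → E u b → E u d → E u e → Closed₅ a b c d e
    pentagon-hub {a} {b} {c} {d} {e} {u} (ab , bc , cd , de , ea) ub ud ue rewrite φ-sym a b | φ-sym e a =
      ⊕-hub _ _ _ _ _ _ _ (quadrilateral bc cd (E-sym ud) ub)
        (trans (quadrilateral (E-sym ab) (E-sym ea) (E-sym ue) ub) (cong (φ b u ⊕_) (sym (triangle ud de ue))))

    pentagon-replace : ∀ {a b c d e u} → E a b → E b c → E u a → E u b → E u c →
                       Closed₅ a u c d e → Closed₅ a b c d e
    pentagon-replace ab bc ua ub uc = ⊕-replace _ _ _ _ _ (bypass ab bc ua ub uc)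

    Chordless : V → V → V → V → V → Set
    Chordless a b c d e = ¬ Chord a c × ¬ Chord b d × ¬ Chord c e × ¬ Chord d a × ¬ Chord e b

    chord-sym : ∀ {x y} → Chord x y → Chord y x
    chord-sym (inj₁ e) = inj₁ (sym e)
    chord-sym (inj₂ e) = inj₂ (E-sym e)

    -- Moving `b` to `p` and `e` to `q` leads to the walk `a p c d q`, in which `pq` is a chord.
    pentagon-bridge : ∀ {a b c d e p q} → Pentagon a b c d e → E p a → E p b → E p c →
                      E q d → E q e → E q a → E p q → Closed₅ a b c d e
    pentagon-bridge (ab , bc , cd , de , ea) pa pb pc qd qe qa pq =
      pentagon-replace ab bc pa pb pc (closed₅-spin (closed₅-spin (closed₅-spin
        (pentagon-replace de ea qd qe qa (closed₅-spin
          (pentagon-chord (qa , E-sym pa , pc , cd , E-sym qd) (inj₂ (E-sym pq))))))))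

    -- The apex `p` is adjacent to `a`, `b` and `c`, and `q` to `d` and `e`. So one more edge from
    -- `p` to `d` or `e`, or from `q` to `b`, completes a hub, and the edges `qa` and `pq` complete
    -- a bridge.
    pentagon-shared : ∀ {a b c d e p} → Pentagon a b c d e → Chordless a b c d e → T a b p → T b c p → Closed₅ a b c d e
    pentagon-shared {a} {b} {c} {d} {e} {p} P@(ab , bc , cd , de@(q , deq) , ea) (¬ac , ¬bd , ¬ce , ¬da , ¬eb) abp bcp =
      meet (cross abp deq)
      where
      pa : E p a
      pa = E-sym (E₁₃ abp)
      pb : E p b
      pb = E-sym (E₂₃ abp)
      pc : E p c
      pc = E-sym (E₂₃ bcp)
      qd : E q d
      qd = E-sym (E₁₃ deq)
      qe : E q e
      qe = E-sym (E₂₃ deq)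
      hub-d : E p d → Closed₅ a b c d e
      hub-d pd = closed₅-spin (closed₅-spin (pentagon-hub (turn (turn P)) pd pa pb))
      hub-e : E p e → Closed₅ a b c d e
      hub-e pe = closed₅-spin (closed₅-spin (closed₅-spin (pentagon-hub (turn (turn (turn P))) pe pb pc)))
      hub-b : E q b → Closed₅ a b c d e
      hub-b qb = pentagon-hub P qb qd qe
      bridge : E q a → E p q → Closed₅ a b c d e
      bridge qa pq = pentagon-bridge P pa pb pc qd qe qa pq
      ad : E a d → Closed₅ a b c d e
      ad x = contradiction (inj₂ (E-sym x)) ¬da
      bd : E b d → Closed₅ a b c d e
      bd x = contradiction (inj₂ x) ¬bd
      be : E b e → Closed₅ a b c d e
      be x = contradiction (inj₂ (E-sym x)) ¬eb
      -- The triangle `eaq` is not yet decisive. It puts `eq` into the link of `a` beside `bp`, and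
      -- an edge joining these two there finishes the argument.
      last : T e a q → Link a b p e q → Closed₅ a b c d e
      last eaq (inj₁ (inj₁ refl))               = contradiction refl (¬eb ∘ inj₁)
      last eaq (inj₁ (inj₂ (inj₁ refl)))        = bd qd
      last eaq (inj₁ (inj₂ (inj₂ (inj₁ refl)))) = be (E₂₃ abp)
      last eaq (inj₁ (inj₂ (inj₂ (inj₂ refl)))) = hub-d qd
      last eaq (inj₂ (inj₁ abe))                = be (E₂₃ abe)
      last eaq (inj₂ (inj₂ (inj₁ abq)))         = hub-b (E-sym (E₂₃ abq))
      last eaq (inj₂ (inj₂ (inj₂ (inj₁ ape))))  = hub-e (E₂₃ ape)
      last eaq (inj₂ (inj₂ (inj₂ (inj₂ apq))))  = bridge (E-sym (E₁₃ apq)) (E₂₃ apq)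
      meet : Cross a b p d e q → Closed₅ a b c d e
      meet (inj₁ (_ , inj₁ refl , inj₁ refl))               = contradiction (inj₁ refl) ¬da
      meet (inj₁ (_ , inj₁ refl , inj₂ (inj₁ refl)))        = contradiction refl (E⇒≢ ea)
      meet (inj₁ (_ , inj₁ refl , inj₂ (inj₂ refl)))        = ad qd
      meet (inj₁ (_ , inj₂ (inj₁ refl) , inj₁ refl))        = contradiction (inj₁ refl) ¬bd
      meet (inj₁ (_ , inj₂ (inj₁ refl) , inj₂ (inj₁ refl))) = contradiction (inj₁ refl) ¬eb
      meet (inj₁ (_ , inj₂ (inj₁ refl) , inj₂ (inj₂ refl))) = bd qd
      meet (inj₁ (_ , inj₂ (inj₂ refl) , inj₁ refl))        = ad (E₁₃ abp)
      meet (inj₁ (_ , inj₂ (inj₂ refl) , inj₂ (inj₁ refl))) = be (E₂₃ abp)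
      meet (inj₁ (_ , inj₂ (inj₂ refl) , inj₂ (inj₂ refl))) = hub-d qd
      meet (inj₂ (inj₁ (inj₁ (inj₁ abd))))                  = ad (E₁₃ abd)
      meet (inj₂ (inj₁ (inj₁ (inj₂ (inj₁ apd)))))           = ad (E₁₃ apd)
      meet (inj₂ (inj₁ (inj₁ (inj₂ (inj₂ bpd)))))           = bd (E₁₃ bpd)
      meet (inj₂ (inj₁ (inj₂ (inj₁ (inj₁ abe)))))           = be (E₂₃ abe)
      meet (inj₂ (inj₁ (inj₂ (inj₁ (inj₂ (inj₁ ape))))))    = hub-e (E₂₃ ape)
      meet (inj₂ (inj₁ (inj₂ (inj₁ (inj₂ (inj₂ bpe))))))    = be (E₁₃ bpe)
      meet (inj₂ (inj₁ (inj₂ (inj₂ (inj₁ abq)))))           = hub-b (E-sym (E₂₃ abq))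
      meet (inj₂ (inj₁ (inj₂ (inj₂ (inj₂ (inj₁ apq))))))    = bridge (E-sym (E₁₃ apq)) (E₂₃ apq)
      meet (inj₂ (inj₁ (inj₂ (inj₂ (inj₂ (inj₂ bpq))))))    = hub-b (E-sym (E₁₃ bpq))
      meet (inj₂ (inj₂ (inj₁ (inj₁ dea))))                  = ad (E-sym (E₁₃ dea))
      meet (inj₂ (inj₂ (inj₁ (inj₂ (inj₁ dqa)))))           = ad (E-sym (E₁₃ dqa))
      meet (inj₂ (inj₂ (inj₁ (inj₂ (inj₂ eqa)))))           = last (T-flip eqa) (link abp (T-swap (T-flip eqa)))
      meet (inj₂ (inj₂ (inj₂ (inj₁ (inj₁ deb)))))           = bd (E-sym (E₁₃ deb))
      meet (inj₂ (inj₂ (inj₂ (inj₁ (inj₂ (inj₁ dqb))))))    = bd (E-sym (E₁₃ dqb))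
      meet (inj₂ (inj₂ (inj₂ (inj₁ (inj₂ (inj₂ eqb))))))    = be (E-sym (E₁₃ eqb))
      meet (inj₂ (inj₂ (inj₂ (inj₂ (inj₁ dep)))))           = hub-d (E-sym (E₁₃ dep))
      meet (inj₂ (inj₂ (inj₂ (inj₂ (inj₂ (inj₁ dqp))))))    = hub-d (E-sym (E₁₃ dqp))
      meet (inj₂ (inj₂ (inj₂ (inj₂ (inj₂ (inj₂ eqp))))))    = hub-e (E-sym (E₁₃ eqp))

    -- Crossing the edges ab and de either closes the pentagon or makes an edge share its apex with the edge ea
    -- (possibly after moving the vertex e).
    pentagon-half : ∀ {a b c d e p q} → Pentagon a b c d e → Chordless a b c d e → T a b p → T d e q →
                    Half a b p d e q → Closed₅ a b c d e
    pentagon-half {a} {b} {c} {d} {e} {p} {q} P@(ab , bc , cd , de , ea) (¬ac , ¬bd , ¬ce , ¬da , ¬eb) abp deq = λ where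
        (inj₁ (inj₁ abd))               → ad (E₁₃ abd)
        (inj₁ (inj₂ (inj₁ apd)))        → ad (E₁₃ apd)
        (inj₁ (inj₂ (inj₂ bpd)))        → bd (E₁₃ bpd)
        (inj₂ (inj₁ (inj₁ abe)))        → be (E₂₃ abe)
        (inj₂ (inj₁ (inj₂ (inj₁ ape)))) → spin⁴ (pentagon-shared (turn⁴ P) (¬eb , ¬ac , ¬bd , ¬ce , ¬da)
                                                   (T-rotate (T-rotate ape)) abp)
        (inj₂ (inj₁ (inj₂ (inj₂ bpe)))) → be (E₁₃ bpe)
        (inj₂ (inj₂ (inj₁ abq)))        → hub-b (E-sym (E₂₃ abq))
        (inj₂ (inj₂ (inj₂ (inj₁ apq)))) → moved (E-sym (E₁₃ apq)) (T-rotate (T-rotate apq))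
        (inj₂ (inj₂ (inj₂ (inj₂ bpq)))) → hub-b (E-sym (E₁₃ bpq))
      where
      turn⁴ : ∀ {a b c d e} → Pentagon a b c d e → Pentagon e a b c d
      turn⁴ = turn ∘ turn ∘ turn ∘ turn
      spin⁴ : ∀ {a b c d e} → Closed₅ e a b c d → Closed₅ a b c d e
      spin⁴ = closed₅-spin ∘ closed₅-spin ∘ closed₅-spin ∘ closed₅-spin
      qd : E q d
      qd = E-sym (E₁₃ deq)
      qe : E q e
      qe = E-sym (E₂₃ deq)
      hub-b : E q b → Closed₅ a b c d e
      hub-b qb = pentagon-hub P qb qd qe
      ad : E a d → Closed₅ a b c d e
      ad x = contradiction (inj₂ (E-sym x)) ¬da
      bd : E b d → Closed₅ a b c d e
      bd x = contradiction (inj₂ x) ¬bd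
      be : E b e → Closed₅ a b c d e
      be x = contradiction (inj₂ (E-sym x)) ¬eb
      moved : E q a → T q a p → Closed₅ a b c d e
      moved qa qap = closed₅-spin (closed₅-spin (closed₅-spin (pentagon-replace de ea qd qe qa
        (closed₅-spin (closed₅-spin Q)))))
        where
        P′ : Pentagon a b c d q
        P′ = ab , bc , cd , E-sym qd , qa
        Q : Closed₅ a b c d q
        -- The diagonals at `q` are new and may exist; the other three are inherited from the
        -- original walk.
        Q with chord? c q | chord? q b
        ... | yes cq | _      = closed₅-spin (closed₅-spin (pentagon-chord (turn (turn P′)) cq))
        ... | _      | yes qb = spin⁴ (pentagon-chord (turn⁴ P′) qb)
        ... | no ¬cq | no ¬qb = spin⁴ (pentagon-shared (turn⁴ P′) (¬qb , ¬ac , ¬bd , ¬cq , ¬da) qap abp)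

    -- The edges `ab` and `de` are disjoint, and reversing the walk exchanges them, so one kind of
    -- joining triangle is enough. Without chords their triangles meet only in a common apex, which
    -- is a hub.
    pentagon : ∀ {a b c d e} → Pentagon a b c d e → Closed₅ a b c d e
    pentagon {a} {b} {c} {d} {e} P@(ab@(p , abp) , bc , cd , de@(q , deq) , ea)
      with chord? a c | chord? b d | chord? c e | chord? d a | chord? e b
    ... | yes ac | _ | _ | _ | _ = pentagon-chord P ac
    ... | no _ | yes bd | _ | _ | _ = closed₅-spin (pentagon-chord (turn P) bd)
    ... | no _ | no _ | yes ce | _ | _ = closed₅-spin (closed₅-spin (pentagon-chord (turn (turn P)) ce))
    ... | no _ | no _ | no _ | yes da | _ =
      closed₅-spin (closed₅-spin (closed₅-spin (pentagon-chord (turn (turn (turn P))) da)))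
    ... | no _ | no _ | no _ | no _ | yes eb =
      closed₅-spin (closed₅-spin (closed₅-spin (closed₅-spin (pentagon-chord (turn (turn (turn (turn P)))) eb))))
    ... | no ¬ac | no ¬bd | no ¬ce | no ¬da | no ¬eb = meet (cross abp deq)
      where
      meet : Cross a b p d e q → Closed₅ a b c d e
      meet (inj₂ (inj₁ half)) = pentagon-half P (¬ac , ¬bd , ¬ce , ¬da , ¬eb) abp deq half
      meet (inj₂ (inj₂ half)) = closed₅-reflect (pentagon-half
        (E-sym de , E-sym cd , E-sym bc , E-sym ab , E-sym ea)
        (¬ce ∘ chord-sym , ¬bd ∘ chord-sym , ¬ac ∘ chord-sym , ¬eb ∘ chord-sym , ¬da ∘ chord-sym)
        (T-swap deq) (T-swap abp) (swap-half half))
        where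
        swap-split : ∀ {x y z w} → Split x y z w → Split y x z w
        swap-split (inj₁ t)        = inj₁ (T-swap t)
        swap-split (inj₂ (inj₁ t)) = inj₂ (inj₂ t)
        swap-split (inj₂ (inj₂ t)) = inj₂ (inj₁ t)
        swap-half : ∀ {x y z u v w} → Half x y z u v w → Half y x z v u w
        swap-half (inj₁ s)        = inj₂ (inj₁ (swap-split s))
        swap-half (inj₂ (inj₁ s)) = inj₁ (swap-split s)
        swap-half (inj₂ (inj₂ s)) = inj₂ (inj₂ (swap-split s))
      meet (inj₁ (_ , inj₁ refl , inj₁ refl))               = contradiction (inj₁ refl) ¬da
      meet (inj₁ (_ , inj₁ refl , inj₂ (inj₁ refl)))        = contradiction refl (E⇒≢ ea)
      meet (inj₁ (_ , inj₁ refl , inj₂ (inj₂ refl)))        = contradiction (inj₂ (E₁₃ deq)) ¬da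
      meet (inj₁ (_ , inj₂ (inj₁ refl) , inj₁ refl))        = contradiction (inj₁ refl) ¬bd
      meet (inj₁ (_ , inj₂ (inj₁ refl) , inj₂ (inj₁ refl))) = contradiction (inj₁ refl) ¬eb
      meet (inj₁ (_ , inj₂ (inj₁ refl) , inj₂ (inj₂ refl))) = contradiction (inj₂ (E₂₃ deq)) ¬eb
      meet (inj₁ (_ , inj₂ (inj₂ refl) , inj₁ refl))        = contradiction (inj₂ (E₂₃ abp)) ¬bd
      meet (inj₁ (_ , inj₂ (inj₂ refl) , inj₂ (inj₁ refl))) = contradiction (inj₂ (E-sym (E₂₃ abp))) ¬eb
      meet (inj₁ (_ , inj₂ (inj₂ refl) , inj₂ (inj₂ refl))) =
        closed₅-spin (closed₅-spin (pentagon-hub (turn (turn P)) (E-sym (E₁₃ deq)) (E-sym (E₁₃ abp)) (E-sym (E₂₃ abp))))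

-- Shellings as lists and their greedy extension

module _ {m : ℕ} where

  _≟ˢ_ : (F G : Subset m) → Dec (F ≡ G)
  _≟ˢ_ = Vec.≡-dec Bool._≟_

  _∈ˡ?_ : (F : Subset m) (L : List (Subset m)) → Dec (F ∈ˡ L)
  F ∈ˡ? L = Any.any? (F ≟ˢ_) L

  Ridge : Subset m → Subset m → Set
  Ridge F H = ∃[ z ] z ∈ F × z ∉ H × (∀ {x} → x ∈ F → x ≢ z → x ∈ H)

  -- Equivalently, F meets the complex generated by L in a pure complex of dimension dim F − 1 (if L is nonempty).
  Attaches : Subset m → List (Subset m) → Set
  Attaches F L = ∀ {G} → G ∈ˡ L → ∃[ H ] H ∈ˡ L × (∀ {x} → x ∈ F → x ∈ G → x ∈ H) × Ridge F H

  -- The most recently added facet comes first.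
  data Shelling : List (Subset m) → Set where
    []  : Shelling []
    _∷_ : ∀ {F L} → Attaches F L → Shelling L → Shelling (F ∷ L)

allSubsets : ∀ n → List (Subset n)
allSubsets zero    = [] ∷ []
allSubsets (suc n) = map (inside ∷_) (allSubsets n) ++ map (outside ∷_) (allSubsets n)

∈-allSubsets : ∀ {n} (F : Subset n) → F ∈ˡ allSubsets n
∈-allSubsets []          = here refl
∈-allSubsets (true ∷ F)  = ∈-++⁺ˡ (∈-map⁺ (inside ∷_) (∈-allSubsets F))
∈-allSubsets (false ∷ F) = ∈-++⁺ʳ (map (inside ∷_) (allSubsets _)) (∈-map⁺ (outside ∷_) (∈-allSubsets F))

module _ {m : ℕ} {S : List (Subset m) → Set} {P : Subset m → Set} (P? : ∀ F → Dec (P F))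
         (progress : ∀ {L} → S L → ∃[ F ] (P F × F ∉ˡ L) → ∃[ F ] (P F × F ∉ˡ L × S (F ∷ L))) where

  private
    -- `R` is a supply containing everything still missing from `L`. Each addition removes an entry
    -- of `R`, so its length bounds the number of steps.
    exhaust : ∀ n {L} R → length R ≤ n → (∀ {F} → P F → F ∈ˡ L ⊎ F ∈ˡ R) → S L →
              ∃[ L′ ] S L′ × (∀ {F} → P F → F ∈ˡ L′)
    exhaust n {L} R R≤n covered s with Any.any? (λ F → P? F ×-dec ¬? (F ∈ˡ? L)) (allSubsets m)
    ... | no none = L , s , all
      where
      all : ∀ {F} → P F → F ∈ˡ L
      all {F} p with F ∈ˡ? L
      ... | yes F∈L = F∈L
      ... | no F∉L = contradiction (Any.map (λ { refl → p , F∉L }) (∈-allSubsets F)) none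
    ... | yes some with progress s (Any.satisfied some)
    ...   | F , p , F∉L , s′ with covered p
    ...     | inj₁ F∈L = contradiction F∈L F∉L
    ...     | inj₂ F∈R with n | ℕ.<-≤-trans (filter-notAll (λ G → ¬? (G ≟ˢ F)) R (Any.map (λ { refl F≢F → F≢F refl }) F∈R)) R≤n
    ...       | suc n | s≤s R′≤n = exhaust n (filter (λ G → ¬? (G ≟ˢ F)) R) R′≤n covered′ s′
      where
      covered′ : ∀ {G} → P G → G ∈ˡ F ∷ L ⊎ G ∈ˡ filter (λ G → ¬? (G ≟ˢ F)) R
      covered′ {G} q with G ≟ˢ F | covered q
      ... | yes refl | _        = inj₁ (here refl)
      ... | no _     | inj₁ G∈L = inj₁ (there G∈L)
      ... | no G≢F   | inj₂ G∈R = inj₂ (∈-filter⁺ (λ G → ¬? (G ≟ˢ F)) G∈R G≢F)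

  -- A missing set only triggers a step; `progress` may add a different one, which lets the
  -- invariant choose the order.
  greedy : ∀ {L} → S L → ∃[ L′ ] S L′ × (∀ {F} → P F → F ∈ˡ L′)
  greedy = exhaust _ (allSubsets m) ℕ.≤-refl (λ _ → inj₂ (∈-allSubsets _))

-- Triangles as vertex sets

module _ {m : ℕ} where

  tri : Fin m → Fin m → Fin m → Subset m
  tri x y z = ⁅ x ⁆ ∪ (⁅ y ⁆ ∪ ⁅ z ⁆)

  ∈tri⁻ : ∀ {x y z u} → u ∈ tri x y z → u ≡ x ⊎ u ≡ y ⊎ u ≡ z
  ∈tri⁻ {x} {y} {z} u∈ with x∈p∪q⁻ ⁅ x ⁆ _ u∈
  ... | inj₁ u∈x = inj₁ (x∈⁅y⁆⇒x≡y x u∈x)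
  ... | inj₂ u∈yz with x∈p∪q⁻ ⁅ y ⁆ _ u∈yz
  ...   | inj₁ u∈y = inj₂ (inj₁ (x∈⁅y⁆⇒x≡y y u∈y))
  ...   | inj₂ u∈z = inj₂ (inj₂ (x∈⁅y⁆⇒x≡y z u∈z))

  ∈tri₁ : ∀ {x y z} → x ∈ tri x y z
  ∈tri₁ = x∈p∪q⁺ (inj₁ (x∈⁅x⁆ _))

  ∈tri₂ : ∀ {x y z} → y ∈ tri x y z
  ∈tri₂ {x} = x∈p∪q⁺ {p = ⁅ x ⁆} (inj₂ (x∈p∪q⁺ (inj₁ (x∈⁅x⁆ _))))

  ∈tri₃ : ∀ {x y z} → z ∈ tri x y z
  ∈tri₃ {x} {y} = x∈p∪q⁺ {p = ⁅ x ⁆} (inj₂ (x∈p∪q⁺ {p = ⁅ y ⁆} (inj₂ (x∈⁅x⁆ _))))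

  ∈tri⁺ : ∀ {x y z u} → u ≡ x ⊎ u ≡ y ⊎ u ≡ z → u ∈ tri x y z
  ∈tri⁺ (inj₁ refl)        = ∈tri₁
  ∈tri⁺ (inj₂ (inj₁ refl)) = ∈tri₂
  ∈tri⁺ (inj₂ (inj₂ refl)) = ∈tri₃

  tri-⊆ : ∀ {x y z} {G : Subset m} → x ∈ G → y ∈ G → z ∈ G → ∀ {u} → u ∈ tri x y z → u ∈ G
  tri-⊆ x∈ y∈ z∈ u∈ with ∈tri⁻ u∈
  ... | inj₁ refl        = x∈
  ... | inj₂ (inj₁ refl) = y∈
  ... | inj₂ (inj₂ refl) = z∈

  pair-⊆ : ∀ {x y} {G : Subset m} → x ∈ G → y ∈ G → ⁅ x ⁆ ∪ ⁅ y ⁆ ⊆ G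
  pair-⊆ {x} {y} x∈ y∈ u∈ with x∈p∪q⁻ ⁅ x ⁆ ⁅ y ⁆ u∈
  ... | inj₁ u∈x rewrite x∈⁅y⁆⇒x≡y x u∈x = x∈
  ... | inj₂ u∈y rewrite x∈⁅y⁆⇒x≡y y u∈y = y∈

  tri-swap : ∀ x y z → tri x y z ≡ tri y x z
  tri-swap x y z = ⊆-antisym (tri-⊆ ∈tri₂ ∈tri₁ ∈tri₃) (tri-⊆ ∈tri₂ ∈tri₁ ∈tri₃)

  tri-rotate : ∀ x y z → tri x y z ≡ tri y z x
  tri-rotate x y z = ⊆-antisym (tri-⊆ ∈tri₃ ∈tri₁ ∈tri₂) (tri-⊆ ∈tri₂ ∈tri₃ ∈tri₁)

  tri-flip : ∀ x y z → tri x y z ≡ tri x z y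
  tri-flip x y z = ⊆-antisym (tri-⊆ ∈tri₁ ∈tri₃ ∈tri₂) (tri-⊆ ∈tri₁ ∈tri₃ ∈tri₂)

module Triangles {m : ℕ} (𝓣 : TripleSystem (Fin m)) where
  open TripleSystem 𝓣

  IsTriangle : Subset m → Set
  IsTriangle F = ∃[ x ] ∃[ y ] ∃[ z ] T x y z × F ≡ tri x y z

  ShellableTriangles : Set
  ShellableTriangles = ∃[ L ] Shelling L × (∀ {F} → F ∈ˡ L → IsTriangle F) ×
                              (∀ {x y z} → T x y z → tri x y z ∈ˡ L)

  private
    T-flip : ∀ {x y z} → T x y z → T x z y
    T-flip = T-swap ∘ T-rotate ∘ T-rotate

  through₁ : ∀ {a b c x} → T a b c → x ∈[ a , b , c ] →
             ∃[ y ] ∃[ z ] T x y z × tri a b c ≡ tri x y z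
  through₁ t (inj₁ refl)        = _ , _ , t , refl
  through₁ t (inj₂ (inj₁ refl)) = _ , _ , T-swap t , tri-swap _ _ _
  through₁ t (inj₂ (inj₂ refl)) = _ , _ , T-rotate (T-rotate t) , trans (tri-rotate _ _ _) (tri-rotate _ _ _)

  through₂ : ∀ {a b c x y} → T a b c → x ∈[ a , b , c ] → y ∈[ a , b , c ] → x ≢ y →
             ∃[ z ] T x y z × tri a b c ≡ tri x y z
  through₂ {a} {b} {c} {x} {y} t x∈ y∈ x≢y with through₁ t x∈
  ... | p , q , t′ , eq with ∈tri⁻ (subst (y ∈_) eq (∈tri⁺ y∈))
  ...   | inj₁ refl        = contradiction refl x≢y
  ...   | inj₂ (inj₁ refl) = _ , t′ , eq
  ...   | inj₂ (inj₂ refl) = _ , T-flip t′ , trans eq (tri-flip _ _ _)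

  through₃ : ∀ {a b c x y z} → T a b c → x ∈[ a , b , c ] → y ∈[ a , b , c ] → z ∈[ a , b , c ] →
             x ≢ y → x ≢ z → y ≢ z → tri a b c ≡ tri x y z
  through₃ {z = z} t x∈ y∈ z∈ x≢y x≢z y≢z with through₂ t x∈ y∈ x≢y
  ... | p , t′ , eq with ∈tri⁻ (subst (z ∈_) eq (∈tri⁺ z∈))
  ...   | inj₁ refl        = contradiction refl x≢z
  ...   | inj₂ (inj₁ refl) = contradiction refl y≢z
  ...   | inj₂ (inj₂ refl) = eq

  crossing-triangle : ∀ {a b c d e f} → Half a b c d e f →
    ∃[ p ] ∃[ q ] ∃[ r ] T p q r × p ∈[ a , b , c ] × q ∈[ a , b , c ] × r ∈[ d , e , f ]
  crossing-triangle {a} {b} {c} = λ where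
      (inj₁ s)        → choose s (inj₁ refl)
      (inj₂ (inj₁ s)) → choose s (inj₂ (inj₁ refl))
      (inj₂ (inj₂ s)) → choose s (inj₂ (inj₂ refl))
    where
    choose : ∀ {w d e f} → Split a b c w → w ∈[ d , e , f ] →
             ∃[ p ] ∃[ q ] ∃[ r ] T p q r × p ∈[ a , b , c ] × q ∈[ a , b , c ] × r ∈[ d , e , f ]
    choose (inj₁ t)        w∈ = _ , _ , _ , t , inj₁ refl , inj₂ (inj₁ refl) , w∈
    choose (inj₂ (inj₁ t)) w∈ = _ , _ , _ , t , inj₁ refl , inj₂ (inj₂ refl) , w∈
    choose (inj₂ (inj₂ t)) w∈ = _ , _ , _ , t , inj₂ (inj₁ refl) , inj₂ (inj₂ refl) , w∈

-- Extending a shelling over the star of a vertex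

module Star {m : ℕ} (𝓣 : TripleSystem (Fin m)) (hereditary : Hereditary 𝓣) (v : Fin m) where
  open TripleSystem 𝓣
  open Hereditary hereditary
  open Triangles 𝓣
  open Cohomology Fin._≟_ 𝓣 hereditary

  -- N x y: the edge xy lies in the deletion of v.
  N : Fin m → Fin m → Set
  N x y = x ≢ v × y ≢ v × (∃[ z ] T x y z × z ≢ v)

  N? : ∀ x y → Dec (N x y)
  N? x y = ¬? (x Fin.≟ v) ×-dec ¬? (y Fin.≟ v) ×-dec Fin.any? (λ z → T? x y z ×-dec ¬? (z Fin.≟ v))

  N-sym : ∀ {x y} → N x y → N y x
  N-sym (x≢v , y≢v , z , t , z≢v) = y≢v , x≢v , z , T-swap t , z≢v

  E? : ∀ x y → Dec (E x y)
  E? x y = Fin.any? (T? x y)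

  -- X x: the vertex x lies in the deletion of v.
  X : Fin m → Set
  X x = ∃[ y ] N x y

  X? : ∀ x → Dec (X x)
  X? x = Fin.any? (N? x)

  N⇒E : ∀ {x y} → N x y → E x y
  N⇒E (_ , _ , z , t , _) = z , t

  -- The cocycle of a cut in the link

  module Cut (g : Fin m → Bool) (g-N : ∀ {x y} → T v x y → N x y → g x ≡ g y) where

    private
      value : ∀ {x y} → Dec (x ≡ v) → Dec (y ≡ v) → Dec (N x y) → Bool
      value {y = y} (yes _) _       _       = g y
      value {x = x} (no _)  (yes _) _       = g x
      value         (no _)  (no _)  (yes _) = false
      value {x} {y} (no _)  (no _)  (no _)  = g x ⊕ g y

    -- The coboundary of g on the star of v, and zero on the deletion of v.
    φ : Fin m → Fin m → Bool
    φ x y = value (x Fin.≟ v) (y Fin.≟ v) (N? x y)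

    φ-v : ∀ y → φ v y ≡ g y
    φ-v y with v Fin.≟ v
    ... | yes _  = refl
    ... | no v≢v = contradiction refl v≢v

    φ-sym : ∀ x y → φ x y ≡ φ y x
    φ-sym x y with x Fin.≟ v | y Fin.≟ v | N? x y | N? y x
    ... | yes refl | yes refl | _     | _     = refl
    ... | yes _    | no _     | _     | _     = refl
    ... | no _     | yes _    | _     | _     = refl
    ... | no _     | no _     | yes _ | yes _ = refl
    ... | no _     | no _     | yes n | no ¬n = contradiction (N-sym n) ¬n
    ... | no _     | no _     | no ¬n | yes n = contradiction (N-sym n) ¬n
    ... | no _     | no _     | no _  | no _  = ⊕-comm _ _

    φ-N : ∀ {x y} → N x y → φ x y ≡ false
    φ-N {x} {y} n with x Fin.≟ v | y Fin.≟ v | N? x y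
    ... | yes x≡v | _       | _     = contradiction x≡v (proj₁ n)
    ... | no _    | yes y≡v | _     = contradiction y≡v (proj₁ (proj₂ n))
    ... | no _    | no _    | yes _ = refl
    ... | no _    | no _    | no ¬n = contradiction n ¬n

    φ-link : ∀ {x y} → T v x y → φ x y ≡ g x ⊕ g y
    φ-link {x} {y} t with x Fin.≟ v | y Fin.≟ v | N? x y
    ... | yes x≡v | _       | _     = contradiction (sym x≡v) (T⇒≢ t)
    ... | no _    | yes y≡v | _     = contradiction (sym y≡v) (T⇒≢ (T-flip t))
    ... | no _    | no _    | yes n = sym (trans (cong (_⊕ g y) (g-N t n)) (⊕-self _))
    ... | no _    | no _    | no _  = refl

    -- On a triangle through `v`, `φ` is the coboundary of `g` with the value `false` put at `v`.
    -- All edges of any other triangle lie in the deletion, where `φ` vanishes. On link edges in the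
    -- deletion both descriptions agree by `g-N`.
    φ-cocycle : Cocycle T φ
    φ-cocycle = cases (_ Fin.≟ v) (_ Fin.≟ v) (_ Fin.≟ v)
      where
      cases : ∀ {x y z} → Dec (x ≡ v) → Dec (y ≡ v) → Dec (z ≡ v) → T x y z → φ x y ⊕ φ y z ≡ φ x z
      cases {x} {y} {z} (yes refl) _ _ t rewrite φ-v y | φ-v z | φ-link t = ⊕-cancelˡ _ _
      cases {x} {y} {z} (no _) (yes refl) _ t rewrite φ-sym x v | φ-v x | φ-v z = sym (φ-link (T-swap t))
      cases {x} {y} {z} (no _) (no _) (yes refl) t
        rewrite φ-sym x v | φ-sym y v | φ-v x | φ-v y | φ-link (T-rotate (T-rotate t)) = ⊕-cancelʳ _ _
      cases {x} {y} {z} (no x≢v) (no y≢v) (no z≢v) t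
        rewrite φ-N (x≢v , y≢v , z , t , z≢v) | φ-N (y≢v , z≢v , x , T-rotate t , x≢v)
              | φ-N (x≢v , z≢v , y , T-flip t , y≢v) = ⊕-self _

    open Closed E? φ φ-sym φ-cocycle

    infix 4 _≈_
    _≈_ : Fin m → Fin m → Set
    x ≈ y = x ≡ y ⊎ N x y

    -- Around `v`, `a`, `u`, `w`, `b` only the two edges at `v` contribute, with `g a` and `g b`.
    -- Coincidences among the vertices shorten the walk to a quadrilateral or a triangle.
    path : ∀ {a u w b} → E v a → E v b → a ≈ u → u ≈ w → w ≈ b → g a ≡ g b
    path _ _ (inj₁ refl) (inj₁ refl) (inj₁ refl) = refl
    path va vb (inj₁ refl) (inj₁ refl) (inj₂ ab) = edge va vb ab
      where
      edge : ∀ {a b} → E v a → E v b → N a b → g a ≡ g b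
      edge {a} {b} va vb ab = trans (sym (⊕-identityʳ _)) (trans (sym (cong₂ _⊕_ (φ-v a) (φ-N ab)))
                                (trans (triangle va (N⇒E ab) vb) (φ-v b)))
    path va vb (inj₁ refl) (inj₂ ab) (inj₁ refl) = path va vb (inj₁ refl) (inj₁ refl) (inj₂ ab)
    path va vb (inj₂ ab) (inj₁ refl) (inj₁ refl) = path va vb (inj₁ refl) (inj₁ refl) (inj₂ ab)
    path va vb (inj₁ refl) (inj₂ au) (inj₂ ub) = corner va vb au ub
      where
      corner : ∀ {a u b} → E v a → E v b → N a u → N u b → g a ≡ g b
      corner {a} {u} {b} va vb au ub =
        trans (sym (⊕-identityʳ _)) (trans (sym (cong₂ _⊕_ (φ-v a) (φ-N au)))
          (trans (quadrilateral va (N⇒E au) (N⇒E ub) (E-sym vb))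
            (trans (cong₂ _⊕_ (φ-v b) (φ-N (N-sym ub))) (⊕-identityʳ _))))
    path va vb (inj₂ au) (inj₁ refl) (inj₂ ub) = path va vb (inj₁ refl) (inj₂ au) (inj₂ ub)
    path va vb (inj₂ au) (inj₂ ub) (inj₁ refl) = path va vb (inj₁ refl) (inj₂ au) (inj₂ ub)
    path {a} {u} {w} {b} va vb (inj₂ au) (inj₂ uw) (inj₂ wb) = ⊕-ends _ _ (begin
      g a ⊕ (false ⊕ (false ⊕ (false ⊕ g b)))
        ≡⟨ cong₂ _⊕_ (φ-v a) (cong₂ _⊕_ (φ-N au) (cong₂ _⊕_ (φ-N uw) (cong₂ _⊕_ (φ-N wb)
             (trans (φ-sym b v) (φ-v b))))) ⟨
      φ v a ⊕ (φ a u ⊕ (φ u w ⊕ (φ w b ⊕ φ b v)))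
        ≡⟨ pentagon (va , N⇒E au , N⇒E uw , N⇒E wb , E-sym vb) ⟩
      false ∎)
      where open ≡-Reasoning

    module Ends {a c d b e f : Fin m} (acd : T a c d) (bef : T b e f)
                (a≢v : a ≢ v) (c≢v : c ≢ v) (d≢v : d ≢ v) (b≢v : b ≢ v) (e≢v : e ≢ v) (f≢v : f ≢ v) where

      ≢v : ∀ {x y z u} → x ≢ v → y ≢ v → z ≢ v → u ∈[ x , y , z ] → u ≢ v
      ≢v x≢v y≢v z≢v (inj₁ refl)        = x≢v
      ≢v x≢v y≢v z≢v (inj₂ (inj₁ refl)) = y≢v
      ≢v x≢v y≢v z≢v (inj₂ (inj₂ refl)) = z≢v

      within : ∀ {x y z u} → T x y z → x ≢ v → y ≢ v → z ≢ v → u ∈[ x , y , z ] → x ≈ u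
      within t x≢v y≢v z≢v (inj₁ refl)        = inj₁ refl
      within t x≢v y≢v z≢v (inj₂ (inj₁ refl)) = inj₂ (x≢v , y≢v , _ , t , z≢v)
      within t x≢v y≢v z≢v (inj₂ (inj₂ refl)) = inj₂ (x≢v , z≢v , _ , T-flip t , y≢v)

      ≈-sym : ∀ {x y} → x ≈ y → y ≈ x
      ≈-sym (inj₁ e) = inj₁ (sym e)
      ≈-sym (inj₂ n) = inj₂ (N-sym n)

      -- The joining triangle has all its vertices in `acd` and `bef`, so it avoids `v` and its
      -- crossing edge lies in the deletion. This bounds the distance by three: one edge in each
      -- triangle and one between them.
      same-side : E v a → E v b → g a ≡ g b
      same-side va vb with cross acd bef
      ... | inj₁ (u , u∈ , u∈′) =
        path va vb (within acd a≢v c≢v d≢v u∈) (inj₁ refl) (≈-sym (within bef b≢v e≢v f≢v u∈′))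
      ... | inj₂ (inj₁ half) with p , q , r , t , p∈ , q∈ , r∈ ← crossing-triangle half =
        path va vb (within acd a≢v c≢v d≢v p∈)
          (inj₂ (≢v a≢v c≢v d≢v p∈ , ≢v b≢v e≢v f≢v r∈ , q , T-flip t , ≢v a≢v c≢v d≢v q∈))
          (≈-sym (within bef b≢v e≢v f≢v r∈))
      ... | inj₂ (inj₂ half) with p , q , r , t , p∈ , q∈ , r∈ ← crossing-triangle half =
        path va vb (within acd a≢v c≢v d≢v r∈)
          (inj₂ (≢v a≢v c≢v d≢v r∈ , ≢v b≢v e≢v f≢v p∈ , q , T-rotate (T-rotate t) , ≢v b≢v e≢v f≢v q∈))
          (≈-sym (within bef b≢v e≢v f≢v p∈))

    cut-constant : ∀ {a b} → E v a → E v b → X a → X b → g a ≡ g b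
    cut-constant va vb (c , a≢v , c≢v , d , acd , d≢v) (e , b≢v , e≢v , f , bef , f≢v) =
      Ends.same-side acd bef a≢v c≢v d≢v b≢v e≢v f≢v va vb

  T⇒≢v : ∀ {x y} → T v x y → x ≢ v × y ≢ v
  T⇒≢v t = T⇒≢ t ∘ sym , T⇒≢ (T-flip t) ∘ sym

  -- The link of `a` contains the edges `vb` and `ef`. An edge joining them gives a star triangle
  -- over `ae` or `af`, or a triangle `abe` or `abf` that puts `ab` into the deletion.
  N-edge-at : ∀ {a b e f} → T v a b → T a e f → e ≢ v → f ≢ v → ∃[ x ] ∃[ y ] T v x y × N x y
  N-edge-at {a} {b} {e} {f} vab aef e≢v f≢v = cases (link (T-swap vab) aef)
    where
    a≢v = proj₁ (T⇒≢v vab)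
    N-ae : T v a e → ∃[ x ] ∃[ y ] T v x y × N x y
    N-ae t = _ , _ , t , a≢v , e≢v , _ , aef , f≢v
    N-af : T v a f → ∃[ x ] ∃[ y ] T v x y × N x y
    N-af t = _ , _ , t , a≢v , f≢v , _ , T-flip aef , e≢v
    cases : Link a v b e f → ∃[ x ] ∃[ y ] T v x y × N x y
    cases (inj₁ (inj₁ v≡e))                 = contradiction (sym v≡e) e≢v
    cases (inj₁ (inj₂ (inj₁ v≡f)))          = contradiction (sym v≡f) f≢v
    cases (inj₁ (inj₂ (inj₂ (inj₁ refl))))  = N-ae vab
    cases (inj₁ (inj₂ (inj₂ (inj₂ refl))))  = N-af vab
    cases (inj₂ (inj₁ ave))                 = N-ae (T-swap ave)
    cases (inj₂ (inj₂ (inj₁ avf)))          = N-af (T-swap avf)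
    cases (inj₂ (inj₂ (inj₂ (inj₁ abe))))   = _ , _ , vab , a≢v , proj₂ (T⇒≢v vab) , _ , abe , e≢v
    cases (inj₂ (inj₂ (inj₂ (inj₂ abf))))   = _ , _ , vab , a≢v , proj₂ (T⇒≢v vab) , _ , abf , f≢v

  -- This supplies the first triangle of the star, which has to meet the triangles avoiding `v` in a
  -- whole edge.
  N-edge : ∀ {a b d e f} → T v a b → T d e f → v ∉ tri d e f → ∃[ x ] ∃[ y ] T v x y × N x y
  N-edge {a} {b} {d} {e} {f} vab def v∉ = cases (cross vab def)
    where
    ≢v : ∀ {u} → u ∈[ d , e , f ] → u ≢ v
    ≢v u∈ refl = v∉ (∈tri⁺ u∈)
    at : ∀ {x y} → T v x y → x ∈[ d , e , f ] → ∃[ x ] ∃[ y ] T v x y × N x y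
    at vxy x∈ with y , z , xyz , eq ← through₁ def x∈ =
      N-edge-at vxy xyz (λ { refl → v∉ (subst (v ∈_) (sym eq) ∈tri₂) })
                        (λ { refl → v∉ (subst (v ∈_) (sym eq) ∈tri₃) })
    two : ∀ {p q r} → T p q r → p ∈[ v , a , b ] → q ∈[ v , a , b ] → r ∈[ d , e , f ] → ∃[ x ] ∃[ y ] T v x y × N x y
    two t (inj₁ refl) _ r∈           = at (T-flip t) r∈
    two t (inj₂ _) (inj₁ refl) r∈    = at (T-flip (T-swap t)) r∈
    two t (inj₂ p∈) (inj₂ q∈) r∈     = _ , _ , vab , proj₁ (T⇒≢v vab) , proj₂ (T⇒≢v vab) , _ , ab p∈ q∈ t , ≢v r∈
      where
      ab : ∀ {p q} → p ≡ a ⊎ p ≡ b → q ≡ a ⊎ q ≡ b → T p q _ → T a b _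
      ab (inj₁ refl) (inj₁ refl) t = contradiction refl (T⇒≢ t)
      ab (inj₁ refl) (inj₂ refl) t = t
      ab (inj₂ refl) (inj₁ refl) t = T-swap t
      ab (inj₂ refl) (inj₂ refl) t = contradiction refl (T⇒≢ t)
    one : ∀ {p q r} → T p q r → p ∈[ d , e , f ] → q ∈[ d , e , f ] → r ∈[ v , a , b ] → ∃[ x ] ∃[ y ] T v x y × N x y
    one t p∈ q∈ (inj₁ refl) with z , pqz , eq ← through₂ def p∈ q∈ (T⇒≢ t) =
      _ , _ , T-rotate (T-rotate t) , ≢v p∈ , ≢v q∈ , z , pqz , λ { refl → v∉ (subst (v ∈_) (sym eq) ∈tri₃) }
    one t p∈ q∈ (inj₂ (inj₁ refl)) = N-edge-at vab (T-rotate (T-rotate t)) (≢v p∈) (≢v q∈)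
    one t p∈ q∈ (inj₂ (inj₂ refl)) = N-edge-at (T-flip vab) (T-rotate (T-rotate t)) (≢v p∈) (≢v q∈)
    cases : Cross v a b d e f → ∃[ x ] ∃[ y ] T v x y × N x y
    cases (inj₁ (_ , inj₁ refl , u∈))        = contradiction refl (≢v u∈)
    cases (inj₁ (_ , inj₂ (inj₁ refl) , u∈)) = at vab u∈
    cases (inj₁ (_ , inj₂ (inj₂ refl) , u∈)) = at (T-flip vab) u∈
    cases (inj₂ (inj₁ half)) with _ , _ , _ , t , p∈ , q∈ , r∈ ← crossing-triangle half = two t p∈ q∈ r∈
    cases (inj₂ (inj₂ half)) with _ , _ , _ , t , p∈ , q∈ , r∈ ← crossing-triangle half = one t p∈ q∈ r∈

  -- Attaching the triangles of the star

  record Extends (L : List (Subset m)) : Set where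
    field
      shelling  : Shelling L
      sound     : ∀ {F} → F ∈ˡ L → IsTriangle F
      base      : ∀ {x y z} → T x y z → v ∉ tri x y z → tri x y z ∈ˡ L

  module Grow {L : List (Subset m)} (ext : Extends L) where
    open Extends ext

    Reached : Fin m → Set
    Reached x = ∃[ y ] T v x y × tri v x y ∈ˡ L

    Reached? : ∀ x → Dec (Reached x)
    Reached? x = Fin.any? (λ y → T? v x y ×-dec tri v x y ∈ˡ? L)

    reached₂ : ∀ {x y} → T v x y → tri v x y ∈ˡ L → Reached y
    reached₂ {x} {y} t ∈L = x , T-flip t , subst (_∈ˡ L) (tri-flip v x y) ∈L

    tri-N : ∀ {x y z} → N x y → T x y z → z ≢ v → v ∉ tri x y z
    tri-N (x≢v , y≢v , _) t z≢v v∈ with ∈tri⁻ v∈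
    ... | inj₁ refl        = x≢v refl
    ... | inj₂ (inj₁ refl) = y≢v refl
    ... | inj₂ (inj₂ refl) = z≢v refl

    avoiding⇒X : ∀ {F x} → IsTriangle F → v ∉ F → x ∈ F → X x
    avoiding⇒X (a , b , c , t , refl) v∉ x∈ with y , z , xyz , eq ← through₁ t (∈tri⁻ x∈) =
      y , (λ { refl → v∉ (subst (v ∈_) (sym eq) ∈tri₁) }) , (λ { refl → v∉ (subst (v ∈_) (sym eq) ∈tri₂) }) ,
      z , xyz , (λ { refl → v∉ (subst (v ∈_) (sym eq) ∈tri₃) })

    -- The edge `vx` is shared with `vxw`. The only danger is an earlier triangle that contains `y`
    -- but neither `v` nor `x`: then `y` must lie on a shared edge, which is `xy` in the first
    -- alternative and `vy` in the second, while the third excludes such a triangle.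
    attach : ∀ {x y} → Reached x → T v x y → tri v x y ∉ˡ L → N x y ⊎ Reached y ⊎ ¬ X y → Attaches (tri v x y) L
    attach {x} {y} (w , vxw , vxw∈L) vxy vxy∉L side {G} G∈L = cases (v ∈? G) (x ∈? G) (y ∈? G)
      where
      v≢x = T⇒≢ vxy
      v≢y = T⇒≢ (T-flip vxy)
      x≢y = T⇒≢ (T-rotate vxy)

      meets : ∀ {H} → (v ∈ G → v ∈ H) → (x ∈ G → x ∈ H) → (y ∈ G → y ∈ H) →
              ∀ {u} → u ∈ tri v x y → u ∈ G → u ∈ H
      meets hv hx hy u∈ u∈G with ∈tri⁻ u∈
      ... | inj₁ refl        = hv u∈G
      ... | inj₂ (inj₁ refl) = hx u∈G
      ... | inj₂ (inj₂ refl) = hy u∈G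

      omit-v : ∀ {H} → v ∉ H → x ∈ H → y ∈ H → Ridge (tri v x y) H
      omit-v v∉ x∈ y∈ = v , ∈tri₁ , v∉ , λ u∈ u≢v → rest u≢v (∈tri⁻ u∈)
        where
        rest : ∀ {u} → u ≢ v → u ∈[ v , x , y ] → u ∈ _
        rest u≢v (inj₁ refl)        = contradiction refl u≢v
        rest u≢v (inj₂ (inj₁ refl)) = x∈
        rest u≢v (inj₂ (inj₂ refl)) = y∈

      omit-x : ∀ {H} → v ∈ H → x ∉ H → y ∈ H → Ridge (tri v x y) H
      omit-x v∈ x∉ y∈ = x , ∈tri₂ , x∉ , λ u∈ u≢x → rest u≢x (∈tri⁻ u∈)
        where
        rest : ∀ {u} → u ≢ x → u ∈[ v , x , y ] → u ∈ _
        rest u≢x (inj₁ refl)        = v∈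
        rest u≢x (inj₂ (inj₁ refl)) = contradiction refl u≢x
        rest u≢x (inj₂ (inj₂ refl)) = y∈

      omit-y : ∀ {H} → v ∈ H → x ∈ H → y ∉ H → Ridge (tri v x y) H
      omit-y v∈ x∈ y∉ = y , ∈tri₃ , y∉ , λ u∈ u≢y → rest u≢y (∈tri⁻ u∈)
        where
        rest : ∀ {u} → u ≢ y → u ∈[ v , x , y ] → u ∈ _
        rest u≢y (inj₁ refl)        = v∈
        rest u≢y (inj₂ (inj₁ refl)) = x∈
        rest u≢y (inj₂ (inj₂ refl)) = contradiction refl u≢y

      y∉vxw : y ∉ tri v x w
      y∉vxw y∈ with ∈tri⁻ y∈
      ... | inj₁ refl        = v≢y refl
      ... | inj₂ (inj₁ refl) = x≢y refl
      ... | inj₂ (inj₂ refl) = vxy∉L vxw∈L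

      Goal : Set
      Goal = ∃[ H ] H ∈ˡ L × (∀ {u} → u ∈ tri v x y → u ∈ G → u ∈ H) × Ridge (tri v x y) H

      free : v ∉ G → x ∉ G → y ∈ G → N x y ⊎ Reached y ⊎ ¬ X y → Goal
      free v∉ x∉ y∈ (inj₁ n@(_ , _ , z , xyz , z≢v)) =
        tri x y z , base xyz (tri-N n xyz z≢v) ,
        meets (λ v∈ → contradiction v∈ v∉) (λ _ → ∈tri₁) (λ _ → ∈tri₂) , omit-v (tri-N n xyz z≢v) ∈tri₁ ∈tri₂
      free v∉ x∉ y∈ (inj₂ (inj₁ (u , vyu , vyu∈L))) =
        tri v y u , vyu∈L , meets (λ _ → ∈tri₁) (λ x∈ → contradiction x∈ x∉) (λ _ → ∈tri₂) , omit-x ∈tri₁ x∉vyu ∈tri₂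
        where
        x∉vyu : x ∉ tri v y u
        x∉vyu x∈ with ∈tri⁻ x∈
        ... | inj₁ refl        = v≢x refl
        ... | inj₂ (inj₁ refl) = x≢y refl
        ... | inj₂ (inj₂ refl) = vxy∉L (subst (_∈ˡ L) (tri-flip v y x) vyu∈L)
      free v∉ x∉ y∈ (inj₂ (inj₂ ¬Xy)) = contradiction (avoiding⇒X (sound G∈L) v∉ y∈) ¬Xy

      cases : Dec (v ∈ G) → Dec (x ∈ G) → Dec (y ∈ G) → Goal
      cases (yes v∈) (yes x∈) (yes y∈) with a , b , c , t , refl ← sound G∈L =
        contradiction (subst (_∈ˡ L) (through₃ t (∈tri⁻ v∈) (∈tri⁻ x∈) (∈tri⁻ y∈) v≢x v≢y x≢y) G∈L) vxy∉L
      cases _ _ (no y∉) =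
        tri v x w , vxw∈L , meets (λ _ → ∈tri₁) (λ _ → ∈tri₂) (λ y∈ → contradiction y∈ y∉) , omit-y ∈tri₁ ∈tri₂ y∉vxw
      cases (yes v∈) (no x∉) (yes y∈) = G , G∈L , (λ _ u∈G → u∈G) , omit-x v∈ x∉ y∈
      cases (no v∉) (yes x∈) (yes y∈) = G , G∈L , (λ _ u∈G → u∈G) , omit-v v∉ x∈ y∈
      cases (no v∉) (no x∉) (yes y∈) = free v∉ x∉ y∈ side

    attach-first : ∀ {x y} → T v x y → N x y → (∀ {F} → F ∈ˡ L → v ∉ F) → Attaches (tri v x y) L
    attach-first {x} {y} vxy n@(_ , _ , z , xyz , z≢v) avoids {G} G∈L =
      tri x y z , base xyz v∉ , meets , v , ∈tri₁ , v∉ , λ u∈ u≢v → rest u≢v (∈tri⁻ u∈)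
      where
      v∉ = tri-N n xyz z≢v
      rest : ∀ {u} → u ≢ v → u ∈[ v , x , y ] → u ∈ tri x y z
      rest u≢v (inj₁ refl)        = contradiction refl u≢v
      rest u≢v (inj₂ (inj₁ refl)) = ∈tri₁
      rest u≢v (inj₂ (inj₂ refl)) = ∈tri₂
      meets : ∀ {u} → u ∈ tri v x y → u ∈ G → u ∈ tri x y z
      meets u∈ u∈G = rest (λ { refl → avoids G∈L u∈G }) (∈tri⁻ u∈)

    extend : ∀ {x y} → T v x y → Attaches (tri v x y) L → Extends (tri v x y ∷ L)
    extend vxy att = record
      { shelling = att ∷ shelling
      ; sound    = λ { (here refl) → _ , _ , _ , vxy , refl ; (there F∈L) → sound F∈L }
      ; base     = λ t v∉ → there (base t v∉)
      }

  Reaches : List (Subset m) → Fin m → Set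
  Reaches L x = ∃[ y ] T v x y × tri v x y ∈ˡ L

  -- The anchor is a reached vertex in the deletion, from which `cut-constant` can transport
  -- reachedness to the other link vertices there.
  record Anchored (L : List (Subset m)) : Set where
    field
      extends : Extends L
      start   : ∃ (Reaches L)
      anchor  : ∃ X → ∃[ r ] Reaches L r × X r

  StarTriangle : Subset m → Set
  StarTriangle F = ∃[ x ] ∃[ y ] T v x y × F ≡ tri v x y

  StarTriangle? : ∀ F → Dec (StarTriangle F)
  StarTriangle? F = Fin.any? λ x → Fin.any? λ y → T? v x y ×-dec F ≟ˢ tri v x y

  module Progress {L : List (Subset m)} (anchored : Anchored L) where
    open Anchored anchored
    open Grow extends

    Step : Set
    Step = ∃[ F ] StarTriangle F × F ∉ˡ L × Anchored (F ∷ L)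

    add : ∀ {x y} → T v x y → tri v x y ∉ˡ L → Attaches (tri v x y) L → Step
    add {x} {y} t ∉L att = _ , (_ , _ , t , refl) , ∉L , record
      { extends = extend t att
      ; start   = weaken (proj₂ start)
      ; anchor  = λ x → let r , reached , Xr = anchor x in r , proj₂ (weaken reached) , Xr
      }
      where
      weaken : ∀ {r} → Reached r → ∃ λ r → Reaches (tri v x y ∷ L) r
      weaken {r} (w , t , ∈L) = r , w , t , there ∈L

    NewEdge : Fin m → Fin m → Set
    NewEdge x y = Reached x × T v x y × N x y × tri v x y ∉ˡ L

    NewEdge? : ∀ x y → Dec (NewEdge x y)
    NewEdge? x y = Reached? x ×-dec T? v x y ×-dec N? x y ×-dec ¬? (tri v x y ∈ˡ? L)

    module Saturated (saturated : ∀ {x y} → ¬ NewEdge x y) where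

      g : Fin m → Bool
      g x = ⌊ Reached? x ⌋

      spread : ∀ {x y} → T v x y → N x y → Reached x → Reached y
      spread {x} {y} t n r with tri v x y ∈ˡ? L
      ... | yes ∈L = reached₂ t ∈L
      ... | no ∉L  = contradiction (r , t , n , ∉L) saturated

      g-N : ∀ {x y} → T v x y → N x y → g x ≡ g y
      g-N {x} {y} t n with Reached? x | Reached? y
      ... | yes _ | yes _ = refl
      ... | no _  | no _  = refl
      ... | yes r | no ¬r = contradiction (spread t n r) ¬r
      ... | no ¬r | yes r = contradiction (spread (T-flip t) (N-sym n) r) ¬r

      -- Saturation makes reachedness constant along link edges in the deletion, so it is an
      -- admissible cut function. It therefore has the same value at `y` as at the anchor.
      X⇒Reached : ∀ {y} → E v y → X y → Reached y
      X⇒Reached {y} vy Xy with r , reached , Xr ← anchor (y , Xy)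
                          with Reached? r | Reached? y | Cut.cut-constant g g-N (_ , proj₁ (proj₂ reached)) vy Xr Xy
      ... | _      | yes ry | _  = ry
      ... | yes _  | no _   | ()
      ... | no ¬rr | no _   | _  = contradiction reached ¬rr

      -- An unreached end is outside the deletion, which is the third alternative of `attach`. If
      -- neither end is reached, the link condition at `v` gives an edge from `xy` to a reached
      -- edge, and the triangle over that edge is added instead.
      next : ∀ {x y} → T v x y → tri v x y ∉ˡ L → Step
      next {x} {y} t ∉L with Reached? x | Reached? y
      ... | yes rx | yes ry = add t ∉L (attach rx t ∉L (inj₂ (inj₁ ry)))
      ... | yes rx | no ¬ry = add t ∉L (attach rx t ∉L (inj₂ (inj₂ (¬ry ∘ X⇒Reached (_ , T-flip t)))))
      ... | no ¬rx | yes ry =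
        add t′ ∉L′ (attach ry t′ ∉L′ (inj₂ (inj₂ (¬rx ∘ X⇒Reached (_ , t)))))
        where
        t′  = T-flip t
        ∉L′ = ∉L ∘ subst (_∈ˡ L) (tri-flip v y x)
      ... | no ¬rx | no ¬ry with r , w , vrw , vrw∈L ← start = cases (link t vrw)
        where
        r-reached : Reached r
        r-reached = w , vrw , vrw∈L
        w-reached : Reached w
        w-reached = reached₂ vrw vrw∈L
        across : ∀ {p q} → Reached p → ¬ Reached q → T v q p → Step
        across {p} {q} rp ¬rq t = add t′ ∉L′ (attach rp t′ ∉L′ (inj₂ (inj₂ (¬rq ∘ X⇒Reached (_ , t)))))
          where
          t′  = T-flip t
          ∉L′ : tri v p q ∉ˡ L
          ∉L′ = ¬rq ∘ reached₂ t′
        cases : Link v x y r w → Step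
        cases (inj₁ (inj₁ refl))               = contradiction r-reached ¬rx
        cases (inj₁ (inj₂ (inj₁ refl)))        = contradiction w-reached ¬rx
        cases (inj₁ (inj₂ (inj₂ (inj₁ refl)))) = contradiction r-reached ¬ry
        cases (inj₁ (inj₂ (inj₂ (inj₂ refl)))) = contradiction w-reached ¬ry
        cases (inj₂ (inj₁ vxr))                = across r-reached ¬rx vxr
        cases (inj₂ (inj₂ (inj₁ vxw)))         = across w-reached ¬rx vxw
        cases (inj₂ (inj₂ (inj₂ (inj₁ vyr))))  = across r-reached ¬ry vyr
        cases (inj₂ (inj₂ (inj₂ (inj₂ vyw))))  = across w-reached ¬ry vyw

    progress : ∃[ F ] StarTriangle F × F ∉ˡ L → Step
    progress (_ , (x , y , t , refl) , ∉L) with Fin.any? (λ x → Fin.any? (NewEdge? x))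
    ... | yes (x , y , rx , t , n , ∉L) = add t ∉L (attach rx t ∉L (inj₁ n))
    ... | no none = Saturated.next (λ new → none (_ , _ , new)) t ∉L

  avoid : ∀ {d e f} → d ≢ v → e ≢ v → f ≢ v → ¬ v ∈[ d , e , f ]
  avoid d≢v e≢v f≢v (inj₁ refl)        = d≢v refl
  avoid d≢v e≢v f≢v (inj₂ (inj₁ refl)) = e≢v refl
  avoid d≢v e≢v f≢v (inj₂ (inj₂ refl)) = f≢v refl

  star-shelling : ∀ {L} → Extends L → (∀ {F} → F ∈ˡ L → v ∉ F) →
                  ShellableTriangles
  star-shelling {L} ext avoids with Fin.any? (λ x → Fin.any? (T? v x))
  ... | no none = L , shelling , sound , λ t → base t (λ v∈ → none′ t v∈)
    where
    open Extends ext
    none′ : ∀ {x y z} → T x y z → v ∉ tri x y z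
    none′ t v∈ with y , z , vyz , _ ← through₁ t (∈tri⁻ v∈) = none (y , z , vyz)
  ... | yes (a , b , vab) = finish (greedy StarTriangle? Progress.progress begun)
    where
    first : (∃[ x ] ∃[ y ] T v x y × (∃ X → N x y) × Attaches (tri v x y) L)
    first with Fin.any? X?
    -- Any triangle in `L` would put its vertices into the deletion, so `L` has no members and every
    -- star triangle can begin.
    ... | no none = a , b , vab , (λ X → contradiction X none) , λ {G} G∈L → contradiction (X-of G∈L) none
      where
      X-of : ∀ {G} → G ∈ˡ L → ∃ X
      X-of G∈L with a , b , c , t , refl ← Extends.sound ext G∈L =
        a , Grow.avoiding⇒X ext (a , b , c , t , refl) (avoids G∈L) ∈tri₁
    ... | yes (d , e , d≢v , e≢v , f , def , f≢v)
      with x , y , vxy , n ← N-edge vab def (λ v∈ → avoid d≢v e≢v f≢v (∈tri⁻ v∈)) =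
        x , y , vxy , (λ _ → n) , Grow.attach-first ext vxy n avoids
    x₀ = proj₁ first
    y₀ = proj₁ (proj₂ first)
    t₀ = proj₁ (proj₂ (proj₂ first))
    n₀ = proj₁ (proj₂ (proj₂ (proj₂ first)))
    begun : Anchored (tri v x₀ y₀ ∷ L)
    begun = record
      { extends = Grow.extend ext t₀ (proj₂ (proj₂ (proj₂ (proj₂ first))))
      ; start   = x₀ , y₀ , t₀ , here refl
      ; anchor  = λ X → x₀ , (y₀ , t₀ , here refl) , y₀ , n₀ X
      }
    finish : ∃[ L′ ] Anchored L′ × (∀ {F} → StarTriangle F → F ∈ˡ L′) → ShellableTriangles
    finish (L′ , anchored , complete) = L′ , shelling , sound , all
      where
      open Extends (Anchored.extends anchored)
      all : ∀ {x y z} → T x y z → tri x y z ∈ˡ L′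
      all {x} {y} {z} t with v ∈? tri x y z
      ... | no v∉ = base t v∉
      ... | yes v∈ with p , q , vpq , eq ← through₁ t (∈tri⁻ v∈) =
        subst (_∈ˡ L′) (sym eq) (complete (p , q , vpq , refl))

-- Consequences of shellability

allSubset? : ∀ {n} {P : Subset n → Set} → (∀ S → Dec (P S)) → Dec (∀ S → P S)
allSubset? P? = map′ (λ none S → decidable-stable (P? S) λ ¬P → none (S , ¬P))
                     (λ all (S , ¬P) → ¬P (all S)) (¬? (anySubset? (λ S → ¬? (P? S))))

module _ {m : ℕ} where

  unique⇒≤∣∣ : ∀ {xs : List (Fin m)} {F : Subset m} → Unique xs → All (_∈ F) xs → length xs ≤ ∣ F ∣
  unique⇒≤∣∣ [] [] = z≤n
  unique⇒≤∣∣ (x∉xs ∷ u) (x∈F ∷ xs⊆F) = ℕ.≤-<-trans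
    (unique⇒≤∣∣ u (All.map (λ (y∈F , x≢y) → x∈p∧x≢y⇒x∈p-y y∈F (x≢y ∘ sym)) (All.zip (xs⊆F , x∉xs))))
    (x∈p⇒∣p-x∣<∣p∣ x∈F)

  ⊆∧≢⇒∃∉ : ∀ {F G : Subset m} → F ⊆ G → F ≢ G → ∃[ x ] x ∈ G × x ∉ F
  ⊆∧≢⇒∃∉ {F} {G} F⊆G F≢G with Fin.any? (λ x → x ∈? G ×-dec ¬? (x ∈? F))
  ... | yes found = found
  ... | no none = contradiction (⊆-antisym F⊆G λ {x} x∈G → decidable-stable (x ∈? F) (λ x∉F → none (x , x∈G , x∉F))) F≢G

  module _ {𝓕 : Family m} (𝓕? : ∀ F → Dec (𝓕 F)) where

    private
      climb : ∀ n {A} → m ∸ ∣ A ∣ ≤ n → 𝓕 A → ∃[ B ] IsFacet 𝓕 B × A ⊆ B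
      climb n {A} bound 𝓕A with anySubset? (λ G → 𝓕? G ×-dec A ⊂? G)
      ... | no none = A , (𝓕A , top) , λ x → x
        where
        top : ∀ G → 𝓕 G → A ⊆ G → A ≡ G
        top G 𝓕G A⊆G = decidable-stable (A ≟ˢ G) λ A≢G → none (G , 𝓕G , A⊆G , ⊆∧≢⇒∃∉ A⊆G A≢G)
      ... | yes (G , 𝓕G , A⊂G) with n | ℕ.<-≤-trans (ℕ.∸-monoʳ-< (p⊂q⇒∣p∣<∣q∣ A⊂G) (∣p∣≤n G)) bound
      ...   | suc n | s≤s bound′ = let B , facet , G⊆B = climb n bound′ 𝓕G in
                                   B , facet , λ x∈A → G⊆B (proj₁ A⊂G x∈A)

    facet-above : ∀ {A} → 𝓕 A → ∃[ B ] IsFacet 𝓕 B × A ⊆ B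
    facet-above = climb _ ℕ.≤-refl

  private
    1+[a-1] : ∀ a → 1ℤ ℤ.+ (a ℤ.- 1ℤ) ≡ a
    1+[a-1] a = trans (ℤ.+-comm 1ℤ (a ℤ.- 1ℤ)) (trans (ℤ.+-assoc a (ℤ.- 1ℤ) 1ℤ) (ℤ.+-identityʳ a))

    1+a-1 : ∀ a → 1ℤ ℤ.+ a ℤ.- 1ℤ ≡ a
    1+a-1 a = trans (ℤ.+-assoc 1ℤ a (ℤ.- 1ℤ)) (1+[a-1] a)

    -1-injective : ∀ {a b} → a ℤ.- 1ℤ ≡ b ℤ.- 1ℤ → a ≡ b
    -1-injective {a} {b} eq = trans (sym (1+[a-1] a)) (trans (cong (λ c → 1ℤ ℤ.+ c) eq) (1+[a-1] b))

  dim-mono : ∀ (F G : Subset m) → ∣ F ∣ ≤ ∣ G ∣ → dim F ℤ.≤ dim G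
  dim-mono F G p = ℤ.+-monoˡ-≤ (ℤ.- 1ℤ) (ℤ.+≤+ p)

  dim-suc : ∀ {F G : Subset m} → dim F ≡ dim G ℤ.- 1ℤ → suc ∣ F ∣ ≡ ∣ G ∣
  dim-suc {F} {G} eq = ℤ.+-injective (trans (cong (λ c → 1ℤ ℤ.+ c) (-1-injective {+ ∣ F ∣} {dim G} eq)) (1+[a-1] (+ ∣ G ∣)))

  suc-dim : ∀ {F G : Subset m} → suc ∣ F ∣ ≡ ∣ G ∣ → dim F ≡ dim G ℤ.- 1ℤ
  suc-dim {F} eq = subst (λ n → dim F ≡ + n ℤ.- 1ℤ ℤ.- 1ℤ) eq (cong (λ a → a ℤ.- 1ℤ) (sym (1+a-1 (+ ∣ F ∣))))

record Order {m : ℕ} (𝓕 : Family m) : Set where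
  field
    t        : ℕ
    facet    : Fin t → Subset m
    isFacet  : ∀ k → IsFacet 𝓕 (facet k)
    complete : ∀ {F} → IsFacet 𝓕 F → ∃[ k ] facet k ≡ F
    ridge    : ∀ {i k} → i Fin.< k → ∃[ j ] j Fin.< k ×
               (∀ {x} → x ∈ facet k → x ∈ facet i → x ∈ facet j) × Ridge (facet k) (facet j)

module _ {m : ℕ} {K : SimplicialComplex m} (shellable : Shellable K) where
  open Shellable shellable

  private
    𝓘 : Fin t → Family m
    𝓘 k G = earlier facet k G × simplex (facet k) G

    𝓘? : ∀ k F → Dec (𝓘 k F)
    𝓘? k F = Fin.any? (λ i → i Fin.<? k ×-dec F ⊆? facet i) ×-dec F ⊆? facet k

    isFacet : ∀ k → IsFacet (Face K) (facet k)
    isFacet k = Equivalence.from (facets (facet k)) (k , refl)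

    facet⊈ : ∀ {j k} → j Fin.< k → ¬ facet k ⊆ facet j
    facet⊈ {j} {k} j<k F⊆G = Fin.<⇒≢ j<k (sym (injective (proj₂ (isFacet k) (facet j) (proj₁ (isFacet j)) F⊆G)))

    -- A facet `A` of the intersection complex above `facet k ∩ facet i` misses exactly one vertex
    -- `z` of `facet k`, and any earlier facet containing `A` serves as `facet j`. It omits `z`,
    -- since otherwise it would contain the whole of `facet k`.
    ridge : ∀ {i k} → i Fin.< k → ∃[ j ] j Fin.< k ×
            (∀ {x} → x ∈ facet k → x ∈ facet i → x ∈ facet j) × Ridge (facet k) (facet j)
    ridge {i} {k} i<k =
      let pure , (B , B∈𝓘 , dimB) , bounded = shelling k (ℕ.≤-<-trans z≤n i<k)
          A , A-facet , ∩⊆A = facet-above (𝓘? k) {facet k ∩ facet i}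
                                ((i , i<k , p∩q⊆q (facet k) (facet i)) , p∩q⊆p (facet k) (facet i))
          -- Purity compares facets only, so the witness of the dimension is first enlarged to a
          -- facet.
          B′ , B′-facet , B⊆B′ = facet-above (𝓘? k) B∈𝓘
          dimB′ = ℤ.≤-antisym (bounded B′ (proj₁ B′-facet))
                    (ℤ.≤-trans (ℤ.≤-reflexive (sym dimB)) (dim-mono B B′ (p⊆q⇒∣p∣≤∣q∣ B⊆B′)))
          size = dim-suc {F = A} {G = facet k} (trans (pure A B′ A-facet B′-facet) dimB′)
          (j , j<k , A⊆Fj) , A⊆Fk = proj₁ A-facet
          z , z∈ , z∉A = ⊆∧≢⇒∃∉ A⊆Fk (λ A≡Fk → ℕ.1+n≢n (trans size (cong ∣_∣ (sym A≡Fk))))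
          rest : ∀ {x} → x ∈ facet k → x ≢ z → x ∈ A
          rest {x} x∈ x≢z = decidable-stable (x ∈? A) λ x∉A → ℕ.<-irrefl size
            (ℕ.≤-trans (s≤s (p⊂q⇒∣p∣<∣q∣ {p = A} {q = facet k - z}
                ((λ {y} y∈A → x∈p∧x≢y⇒x∈p-y (A⊆Fk y∈A) λ y≡z → z∉A (subst (_∈ A) y≡z y∈A)) , x , x∈p∧x≢y⇒x∈p-y x∈ x≢z , x∉A)))
              (x∈p⇒∣p-x∣<∣p∣ z∈))
      in j , j<k , (λ x∈k x∈i → A⊆Fj (∩⊆A (x∈p∩q⁺ (x∈k , x∈i)))) , z , z∈ ,
         (λ z∈j → facet⊈ j<k λ {x} x∈k → within z∈j A⊆Fj rest x∈k) , λ x∈ x≢z → A⊆Fj (rest x∈ x≢z)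
      where
      within : ∀ {A j z} → z ∈ facet j → A ⊆ facet j → (∀ {x} → x ∈ facet k → x ≢ z → x ∈ A) → facet k ⊆ facet j
      within {z = z} z∈j A⊆j rest {x} x∈k with x Fin.≟ z
      ... | yes refl = z∈j
      ... | no x≢z   = A⊆j (rest x∈k x≢z)

  shellable⇒order : Order (Face K)
  shellable⇒order = record
    { t        = t
    ; facet    = facet
    ; isFacet  = isFacet
    ; complete = λ F → Equivalence.to (facets _) F
    ; ridge    = ridge
    }

-- Connectivity and vanishing cohomology as decidable conditions

module _ {m : ℕ} where

  -- The partners `y` and `y′` restrict the comparison to vertices that have an edge, so isolated
  -- vertices do not disconnect.
  Connected : (Fin m → Fin m → Set) → Set
  Connected R = ∀ (f : Subset m) → (∀ x y → R x y → lookup f x ≡ lookup f y) →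
                ∀ x y x′ y′ → R x y → R x′ y′ → lookup f x ≡ lookup f x′

  Connected? : ∀ {R} → (∀ x y → Dec (R x y)) → Dec (Connected R)
  Connected? R? = allSubset? λ f →
    (Fin.all? λ x → Fin.all? λ y → R? x y →-dec lookup f x Bool.≟ lookup f y) →-dec
    (Fin.all? λ x → Fin.all? λ y → Fin.all? λ x′ → Fin.all? λ y′ →
       R? x y →-dec R? x′ y′ →-dec lookup f x Bool.≟ lookup f x′)

module _ {m : ℕ} (𝓕 : Family m) where

  Triangle : Fin m → Fin m → Fin m → Set
  Triangle x y z = x ≢ y × y ≢ z × x ≢ z × 𝓕 (tri x y z)

  Edge : Fin m → Fin m → Set
  Edge x y = x ≢ y × 𝓕 (⁅ x ⁆ ∪ ⁅ y ⁆)

  -- This is the vanishing of the first cohomology over Z/2 of the complex generated by the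
  -- triangles; `Φ` is a cochain stored as an `m` by `m` matrix of bits.
  Acyclic : Set
  Acyclic = ∀ (Φ : Subset (m * m)) →
    (∀ x y z → Triangle x y z →
       lookup Φ (combine x y) ⊕ lookup Φ (combine y z) ≡ lookup Φ (combine x z)) →
    ∃[ f ] (∀ x y z → Triangle x y z → lookup Φ (combine x y) ≡ lookup f x ⊕ lookup f y)

  -- Quantifying over functions encoded as subsets keeps these conditions decidable, which is what allows a bad
  -- subcomplex to be found by search.
  Locally : Set
  Locally = Acyclic × Connected (λ x y → ∃[ z ] Triangle x y z) × (∀ v → Connected (Triangle v)) × Connected Edge

  module _ (𝓕? : ∀ F → Dec (𝓕 F)) where

    Triangle? : ∀ x y z → Dec (Triangle x y z)
    Triangle? x y z = ¬? (x Fin.≟ y) ×-dec ¬? (y Fin.≟ z) ×-dec ¬? (x Fin.≟ z) ×-dec 𝓕? (tri x y z)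

    Edge? : ∀ x y → Dec (Edge x y)
    Edge? x y = ¬? (x Fin.≟ y) ×-dec 𝓕? (⁅ x ⁆ ∪ ⁅ y ⁆)

    Locally? : Dec Locally
    Locally? =
      (allSubset? λ Φ →
        (Fin.all? λ x → Fin.all? λ y → Fin.all? λ z → Triangle? x y z →-dec
           lookup Φ (combine x y) ⊕ lookup Φ (combine y z) Bool.≟ lookup Φ (combine x z)) →-dec
        anySubset? λ f → Fin.all? λ x → Fin.all? λ y → Fin.all? λ z → Triangle? x y z →-dec
           lookup Φ (combine x y) Bool.≟ lookup f x ⊕ lookup f y)
      ×-dec Connected? (λ x y → Fin.any? (Triangle? x y))
      ×-dec Fin.all? (λ v → Connected? (Triangle? v))
      ×-dec Connected? Edge?

-- Shelling orders satisfy the local conditions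

module _ {m : ℕ} (K : SimplicialComplex m) (∣F∣≤3 : ∀ {F} → Face K F → ∣ F ∣ ≤ 3) where

  triangles : TripleSystem (Fin m)
  triangles = record
    { T        = Triangle (Face K)
    ; T?       = Triangle? (Face K) (face? K)
    ; T-swap   = λ {x} {y} {z} (x≢y , y≢z , x≢z , F) → x≢y ∘ sym , x≢z , y≢z , subst (Face K) (tri-swap x y z) F
    ; T-rotate = λ {x} {y} {z} (x≢y , y≢z , x≢z , F) →
                   y≢z , x≢z ∘ sym , x≢y ∘ sym , subst (Face K) (tri-rotate x y z) F
    ; T⇒≢      = proj₁
    }

  open TripleSystem triangles
  open Triangles triangles

  face⇒triangle : ∀ {F x y z} → Face K F → x ∈ F → y ∈ F → z ∈ F → x ≢ y → y ≢ z → x ≢ z →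
                  T x y z × F ≡ tri x y z
  face⇒triangle {F} {x} {y} {z} F∈K x∈ y∈ z∈ x≢y y≢z x≢z =
    (x≢y , y≢z , x≢z , ⊆-closed K (tri-⊆ x∈ y∈ z∈) F∈K) , ⊆-antisym F⊆ (tri-⊆ x∈ y∈ z∈)
    where
    F⊆ : F ⊆ tri x y z
    F⊆ {u} u∈ with u Fin.≟ x | u Fin.≟ y | u Fin.≟ z
    ... | yes refl | _        | _        = ∈tri₁
    ... | no _     | yes refl | _        = ∈tri₂ {x = x}
    ... | no _     | no _     | yes refl = ∈tri₃ {x = x} {y = y}
    ... | no u≢x   | no u≢y   | no u≢z   = contradiction
      (ℕ.≤-trans (unique⇒≤∣∣ ((u≢x ∷ u≢y ∷ u≢z ∷ []) ∷ (x≢y ∷ x≢z ∷ []) ∷ (y≢z ∷ []) ∷ [] ∷ [])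
                              (u∈ ∷ x∈ ∷ y∈ ∷ z∈ ∷ []))
                 (∣F∣≤3 F∈K))
      (ℕ.<-irrefl refl)

  triangle-facet : ∀ {x y z} → T x y z → IsFacet (Face K) (tri x y z)
  triangle-facet (x≢y , y≢z , x≢z , F) = F , λ G G∈K F⊆G → sym (proj₂
    (face⇒triangle G∈K (F⊆G ∈tri₁) (F⊆G ∈tri₂) (F⊆G ∈tri₃) x≢y y≢z x≢z))

  module _ (order : Order (Face K)) where
    open Order order

    outside-facet : ∀ {j k} → Ridge (facet k) (facet j) → ∃[ u ] u ∈ facet j × u ∉ facet k
    outside-facet {j} {k} (z , z∈k , z∉j , _) with Fin.any? (λ u → u ∈? facet j ×-dec ¬? (u ∈? facet k))
    ... | yes found = found
    ... | no none = contradiction z∈k λ z∈k → z∉j (subst (z ∈_) (sym j≡k) z∈k)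
      where
      j≡k : facet j ≡ facet k
      j≡k = proj₂ (isFacet j) _ (proj₁ (isFacet k))
              λ {u} u∈j → decidable-stable (u ∈? facet k) λ u∉k → none (u , u∈j , u∉k)

    -- `facet j` keeps two vertices of the triangle and, being another facet, has a vertex outside
    -- it, so it is a triangle too. This lets arguments about triangles run through a nonpure
    -- shelling.
    triangle-before : ∀ {j k} → IsTriangle (facet k) → Ridge (facet k) (facet j) →
                      ∃[ x ] ∃[ y ] ∃[ z ] T x y z × facet k ≡ tri x y z × x ∈ facet j × y ∈ facet j ×
                                           z ∉ facet j × IsTriangle (facet j)
    triangle-before {j} {k} (a , b , c , t , eq) ridge@(z , z∈k , z∉j , rest)
      with x , y , zxy , eq′ ← through₁ t (∈tri⁻ (subst (z ∈_) eq z∈k))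
      with u , u∈j , u∉k ← outside-facet ridge =
        x , y , z , T-rotate zxy , trans eqᶻ (tri-rotate z x y) , x∈j , y∈j , z∉j ,
        x , y , u , face⇒triangle (proj₁ (isFacet j)) x∈j y∈j u∈j (T⇒≢ (T-rotate zxy))
          (λ { refl → u∉k y∈k }) (λ { refl → u∉k x∈k })
      where
      eqᶻ = trans eq eq′
      x∈k = subst (x ∈_) (sym eqᶻ) (∈tri₂ {x = z})
      y∈k = subst (y ∈_) (sym eqᶻ) (∈tri₃ {x = z} {y = x})
      x∈j = rest x∈k (T⇒≢ zxy ∘ sym)
      y∈j = rest y∈k (T⇒≢ (T-rotate (T-rotate zxy)))

    -- One induction serves all three connectivity statements: `Q` selects facets and `W` the
    -- vertices that count. For `i` before `k`, the facet `j` given by `ridge` shares a relevant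
    -- vertex with `facet k`, and both `i` and `j` precede `k`.
    module Agreement (f : Fin m → Bool) (W : Fin m → Set) (Q : Subset m → Set)
      (constant : ∀ {F x y} → Face K F → Q F → x ∈ F → y ∈ F → W x → W y → f x ≡ f y)
      (step : ∀ {i j k} → Q (facet i) → Q (facet k) → (∀ {x} → x ∈ facet k → x ∈ facet i → x ∈ facet j) →
              Ridge (facet k) (facet j) → Q (facet j) × ∃[ x ] x ∈ facet j × x ∈ facet k × W x) where

      private
        agree-below : ∀ n {i k x y} → toℕ i < n → toℕ k < n → Q (facet i) → Q (facet k) →
                      x ∈ facet i → y ∈ facet k → W x → W y → f x ≡ f y

        agree-< : ∀ n {i k x y} → i Fin.< k → toℕ k < suc n → Q (facet i) → Q (facet k) →
                  x ∈ facet i → y ∈ facet k → W x → W y → f x ≡ f y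
        agree-< n i<k (s≤s k≤n) Qi Qk x∈i y∈k Wx Wy =
          let j , j<k , meet , rdg = ridge i<k
              Qj , u , u∈j , u∈k , Wu = step Qi Qk meet rdg
          in trans (agree-below n (ℕ.<-≤-trans i<k k≤n) (ℕ.<-≤-trans j<k k≤n) Qi Qj x∈i u∈j Wx Wu)
                   (constant (proj₁ (isFacet _)) Qk u∈k y∈k Wu Wy)

        agree-below (suc n) {i} {k} i<n k<n Qi Qk x∈i y∈k Wx Wy with ℕ.<-cmp (toℕ i) (toℕ k)
        ... | tri< i<k _ _ = agree-< n i<k k<n Qi Qk x∈i y∈k Wx Wy
        ... | tri> _ _ k<i = sym (agree-< n k<i i<n Qk Qi y∈k x∈i Wy Wx)
        ... | tri≈ _ i≡k _ with refl ← Fin.toℕ-injective i≡k = constant (proj₁ (isFacet i)) Qi x∈i y∈k Wx Wy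

      agree : ∀ {F G x y} → IsFacet (Face K) F → IsFacet (Face K) G → Q F → Q G →
              x ∈ F → y ∈ G → W x → W y → f x ≡ f y
      agree F G with _ , refl ← complete F | _ , refl ← complete G =
        agree-below t (Fin.toℕ<n _) (Fin.toℕ<n _)

    order⇒triangles-connected : Connected E
    order⇒triangles-connected f f-E x y x′ y′ (z , t) (z′ , t′) =
      Agreement.agree (lookup f) (λ _ → Unit) IsTriangle constant step (triangle-facet t) (triangle-facet t′)
        (_ , _ , _ , t , refl) (_ , _ , _ , t′ , refl) ∈tri₁ ∈tri₁ _ _
      where
      constant : ∀ {F x y} → Face K F → IsTriangle F → x ∈ F → y ∈ F → Unit → Unit → lookup f x ≡ lookup f y
      constant {x = x} {y} _ (_ , _ , _ , t , refl) x∈ y∈ _ _ with x Fin.≟ y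
      ... | yes refl = refl
      ... | no x≢y with z , xyz , _ ← through₂ t (∈tri⁻ x∈) (∈tri⁻ y∈) x≢y = f-E x y (z , xyz)
      step : ∀ {i j k} → IsTriangle (facet i) → IsTriangle (facet k) →
             (∀ {x} → x ∈ facet k → x ∈ facet i → x ∈ facet j) →
             Ridge (facet k) (facet j) → IsTriangle (facet j) × ∃[ x ] x ∈ facet j × x ∈ facet k × Unit
      step _ tk _ ridge with x , y , z , t , eq , x∈j , _ , _ , tj ← triangle-before tk ridge =
        tj , x , x∈j , subst (x ∈_) (sym eq) ∈tri₁ , _

    order⇒link-connected : ∀ v → Connected (T v)
    order⇒link-connected v f f-link x y x′ y′ t t′ =
      Agreement.agree (lookup f) (_≢ v) (λ F → IsTriangle F × v ∈ F) constant step
        (triangle-facet t) (triangle-facet t′)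
        ((_ , _ , _ , t , refl) , ∈tri₁) ((_ , _ , _ , t′ , refl) , ∈tri₁) (∈tri₂ {x = v}) (∈tri₂ {x = v})
        (T⇒≢ t ∘ sym) (T⇒≢ t′ ∘ sym)
      where
      constant : ∀ {F x y} → Face K F → IsTriangle F × v ∈ F → x ∈ F → y ∈ F → x ≢ v → y ≢ v → lookup f x ≡ lookup f y
      constant {x = x} {y} F∈K (_ , v∈) x∈ y∈ x≢v y≢v with x Fin.≟ y
      ... | yes refl = refl
      ... | no x≢y = f-link x y (proj₁ (face⇒triangle F∈K v∈ x∈ y∈ (x≢v ∘ sym) x≢y (y≢v ∘ sym)))
      step : ∀ {i j k} → IsTriangle (facet i) × v ∈ facet i → IsTriangle (facet k) × v ∈ facet k →
             (∀ {x} → x ∈ facet k → x ∈ facet i → x ∈ facet j) → Ridge (facet k) (facet j) →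
             (IsTriangle (facet j) × v ∈ facet j) × ∃[ x ] x ∈ facet j × x ∈ facet k × x ≢ v
      step {j = j} {k} (_ , v∈i) (tk , v∈k) meet ridge
        with x , y , z , t , eq , x∈j , y∈j , _ , tj ← triangle-before tk ridge
        with x Fin.≟ v
      ... | no x≢v   = (tj , meet v∈k v∈i) , x , x∈j , subst (x ∈_) (sym eq) ∈tri₁ , x≢v
      ... | yes refl = (tj , meet v∈k v∈i) , y , y∈j , subst (y ∈_) (sym eq) (∈tri₂ {x = x}) , T⇒≢ t ∘ sym

    order⇒edges-connected : Connected (Edge (Face K))
    order⇒edges-connected f f-edge x y x′ y′ e@(x≢y , xy) e′@(x′≢y′ , xy′) =
      let F , F-facet , xy⊆F = facet-above (face? K) xy
          G , G-facet , xy′⊆G = facet-above (face? K) xy′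
      in Agreement.agree (lookup f) (λ _ → Unit) Wide constant step F-facet G-facet
           (x , y , xy⊆F ∈ₗ , xy⊆F ∈ᵣ , x≢y) (x′ , y′ , xy′⊆G ∈ₗ , xy′⊆G ∈ᵣ , x′≢y′) (xy⊆F ∈ₗ) (xy′⊆G ∈ₗ) _ _
      where
      Wide : Subset m → Set
      Wide F = ∃[ x ] ∃[ y ] x ∈ F × y ∈ F × x ≢ y
      ∈ₗ : ∀ {x y} → x ∈ ⁅ x ⁆ ∪ ⁅ y ⁆
      ∈ₗ = x∈p∪q⁺ (inj₁ (x∈⁅x⁆ _))
      ∈ᵣ : ∀ {x y} → y ∈ ⁅ x ⁆ ∪ ⁅ y ⁆
      ∈ᵣ {x} = x∈p∪q⁺ {p = ⁅ x ⁆} (inj₂ (x∈⁅x⁆ _))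
      constant : ∀ {F x y} → Face K F → Wide F → x ∈ F → y ∈ F → Unit → Unit → lookup f x ≡ lookup f y
      constant {x = x} {y} F∈K _ x∈ y∈ _ _ with x Fin.≟ y
      ... | yes refl = refl
      ... | no x≢y = f-edge x y (x≢y , ⊆-closed K (pair-⊆ x∈ y∈) F∈K)
      step : ∀ {i j k} → Wide (facet i) → Wide (facet k) → (∀ {x} → x ∈ facet k → x ∈ facet i → x ∈ facet j) →
             Ridge (facet k) (facet j) → Wide (facet j) × ∃[ x ] x ∈ facet j × x ∈ facet k × Unit
      step _ (a , b , a∈ , b∈ , a≢b) _ rdg@(z , z∈k , z∉j , rest) with u , u∈j , u∉k ← outside-facet rdg
        with a Fin.≟ z
      ... | no a≢z   = (a , u , rest a∈ a≢z , u∈j , λ { refl → u∉k a∈ }) , a , rest a∈ a≢z , a∈ , _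
      ... | yes refl = (b , u , rest b∈ (a≢b ∘ sym) , u∈j , λ { refl → u∉k b∈ }) , b , rest b∈ (a≢b ∘ sym) , b∈ , _

    IsTriangle? : ∀ F → Dec (IsTriangle F)
    IsTriangle? F = Fin.any? λ x → Fin.any? λ y → Fin.any? λ z → T? x y z ×-dec F ≟ˢ tri x y z

    module Potential (φ : Fin m → Fin m → Bool) (cocycle : Cocycle T φ) where

      -- Adding `φ x z` to either side gives `φ y z`, by the cocycle condition.
      φ-sym : ∀ {x y z} → T x y z → φ x y ≡ φ y x
      φ-sym {x} {y} {z} t = trans (sym (⊕-cancelʳ _ _)) (trans (cong (_⊕ φ x z) shift) (⊕-cancelʳ _ _))
        where
        shift : φ x y ⊕ φ x z ≡ φ y x ⊕ φ x z
        shift = trans (cong (φ x y ⊕_) (sym (cocycle t))) (trans (⊕-cancelˡ _ _) (sym (cocycle (T-swap t))))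

      Potential : (Fin m → Bool) → Subset m → Set
      Potential f F = ∀ x y → x ∈ F → y ∈ F → x ≢ y → φ x y ≡ f x ⊕ f y

      potential-on : ∀ {f x y z} → T x y z → φ x y ≡ f x ⊕ f y → φ x z ≡ f x ⊕ f z → Potential f (tri x y z)
      potential-on {f} {x} {y} {z} t xy xz a b a∈ b∈ a≢b = cases (∈tri⁻ a∈) (∈tri⁻ b∈) a≢b
        where
        yz : φ y z ≡ f y ⊕ f z
        yz = trans (sym (cocycle (T-swap t))) (trans (cong₂ _⊕_ (trans (sym (φ-sym t)) (trans xy (⊕-comm _ _))) xz)
                                                       (⊕-telescope _ _ _))
        flip : ∀ {x y z} → T x y z → φ x y ≡ f x ⊕ f y → φ y x ≡ f y ⊕ f x
        flip t eq = trans (sym (φ-sym t)) (trans eq (⊕-comm _ _))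
        cases : ∀ {a b} → a ∈[ x , y , z ] → b ∈[ x , y , z ] → a ≢ b → φ a b ≡ f a ⊕ f b
        cases (inj₁ refl)        (inj₁ refl)        a≢b = contradiction refl a≢b
        cases (inj₁ refl)        (inj₂ (inj₁ refl)) _   = xy
        cases (inj₁ refl)        (inj₂ (inj₂ refl)) _   = xz
        cases (inj₂ (inj₁ refl)) (inj₁ refl)        _   = flip t xy
        cases (inj₂ (inj₁ refl)) (inj₂ (inj₁ refl)) a≢b = contradiction refl a≢b
        cases (inj₂ (inj₁ refl)) (inj₂ (inj₂ refl)) _   = yz
        cases (inj₂ (inj₂ refl)) (inj₁ refl)        _   = flip (T-swap (T-rotate (T-rotate t))) xz
        cases (inj₂ (inj₂ refl)) (inj₂ (inj₁ refl)) _   = flip (T-rotate t) yz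
        cases (inj₂ (inj₂ refl)) (inj₂ (inj₂ refl)) a≢b = contradiction refl a≢b

      module Extend (k : Fin t) (f : Fin m → Bool)
                    (before : ∀ {i} → i Fin.< k → IsTriangle (facet i) → Potential f (facet i)) where

        Old : Fin m → Set
        Old u = ∃[ i ] i Fin.< k × IsTriangle (facet i) × u ∈ facet i

        Old? : ∀ u → Dec (Old u)
        Old? u = Fin.any? λ i → i Fin.<? k ×-dec IsTriangle? (facet i) ×-dec u ∈? facet i

        module From (ref : Fin m) where

          f′ : Fin m → Bool
          f′ u with Old? u | u Fin.≟ ref
          ... | yes _ | _     = f u
          ... | no _  | yes _ = f u
          ... | no _  | no _  = f ref ⊕ φ ref u

          f′-old : ∀ {u} → Old u → f′ u ≡ f u
          f′-old {u} old with Old? u | u Fin.≟ ref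
          ... | yes _   | _ = refl
          ... | no ¬old | _ = contradiction old ¬old

          f′-ref : f′ ref ≡ f ref
          f′-ref with Old? ref | ref Fin.≟ ref
          ... | yes _ | _      = refl
          ... | no _  | yes _  = refl
          ... | no _  | no r≢r = contradiction refl r≢r

          new-edge : ∀ {u} → ¬ Old u → u ≢ ref → φ ref u ≡ f′ ref ⊕ f′ u
          new-edge {u} ¬old u≢ref rewrite f′-ref = trans (sym (⊕-cancelˡ _ _)) (cong (f ref ⊕_) (sym f′-new))
            where
            f′-new : f′ u ≡ f ref ⊕ φ ref u
            f′-new with Old? u | u Fin.≟ ref
            ... | yes old | _       = contradiction old ¬old
            ... | no _    | yes u≡r = contradiction u≡r u≢ref
            ... | no _    | no _    = refl

          old-edge : ∀ {i} → i Fin.< k → IsTriangle (facet i) → Potential f′ (facet i)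
          old-edge i<k ti x y x∈ y∈ x≢y = trans (before i<k ti x y x∈ y∈ x≢y)
            (sym (cong₂ _⊕_ (f′-old (_ , i<k , ti , x∈)) (f′-old (_ , i<k , ti , y∈))))

        -- New vertices take the value that `φ` prescribes from a reference vertex, old ones keep
        -- theirs. If the triangle touches an earlier one, a ridge provides an old edge `xy`, and
        -- only the third vertex `z` remains to be examined.
        extension : IsTriangle (facet k) → ∃[ f′ ] (∀ {i} → i Fin.< k → IsTriangle (facet i) → Potential f′ (facet i)) ×
                                                   Potential f′ (facet k)
        extension tk@(a , b , c , abc , eq) with Fin.any? (λ u → u ∈? facet k ×-dec Old? u)
        ... | no none = f′ , old-edge , subst (Potential f′) (sym eq) (potential-on abc
                (new-edge (λ old → none (b , subst (b ∈_) (sym eq) (∈tri₂ {x = a}) , old)) (T⇒≢ abc ∘ sym))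
                (new-edge (λ old → none (c , subst (c ∈_) (sym eq) (∈tri₃ {x = a}) , old)) (T⇒≢ (T-rotate (T-rotate abc)))))
          where open From a
        ... | yes (u , u∈k , i , i<k , ti , u∈i)
          with j , j<k , _ , rdg ← ridge i<k
          with x , y , z , xyz , eq , x∈j , y∈j , z∉j , tj ← triangle-before tk rdg =
            f′ , old-edge , subst (Potential f′) (sym eq) (closing (Old? z))
          where
          open From x
          z∈k = subst (z ∈_) (sym eq) (∈tri₃ {x = x})
          y∈k = subst (y ∈_) (sym eq) (∈tri₂ {x = x})
          x∈k = subst (x ∈_) (sym eq) ∈tri₁
          z≢x = T⇒≢ (T-rotate (T-rotate xyz))
          xy = old-edge j<k tj x y x∈j y∈j (T⇒≢ xyz)
          closing : Dec (Old z) → Potential f′ (tri x y z)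
          closing (no ¬old) = potential-on xyz xy (new-edge ¬old z≢x)
          -- Here `z` already has a value. The ridge for an earlier triangle through `z` keeps `z`
          -- and so omits just one of `x` and `y`; hence two edges of `xyz` lie in earlier
          -- triangles, and the cocycle condition settles the third.
          closing (yes (i , i<k , ti , z∈i)) with ridge i<k
          ... | j , j<k , meet , rdg@(w , w∈k , w∉j , rest) with _ , _ , _ , _ , _ , _ , _ , _ , tj ← triangle-before tk rdg
                                                            with x Fin.≟ w
          ...   | no x≢w   = potential-on xyz xy (old-edge j<k tj x z (rest x∈k x≢w) (meet z∈k z∈i) (z≢x ∘ sym))
          ...   | yes refl = subst (Potential f′) (tri-swap y x z)
            (potential-on (T-swap xyz) (trans (sym (φ-sym xyz)) (trans xy (⊕-comm _ _)))
              (old-edge j<k tj y z (rest y∈k (T⇒≢ xyz ∘ sym)) (meet z∈k z∈i) (T⇒≢ (T-rotate xyz))))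

      private
        stage : ∀ n → ∃[ f ] (∀ {i} → toℕ i < n → IsTriangle (facet i) → Potential f (facet i))
        stage zero = (λ _ → false) , λ ()
        stage (suc n) with stage n | n ℕ.<? t
        ... | f , below | no n≮t = f , λ {i} _ → below (ℕ.<-≤-trans (Fin.toℕ<n i) (ℕ.≮⇒≥ n≮t))
        ... | f , below | yes n<t with IsTriangle? (facet (Fin.fromℕ< n<t))
        ...   | no ¬tk = f , λ {i} i≤n ti → below (ℕ.≤∧≢⇒< (ℕ.≤-pred i≤n)
                  λ i≡n → ¬tk (subst (IsTriangle ∘ facet) (Fin.toℕ-injective (trans i≡n (sym (Fin.toℕ-fromℕ< n<t)))) ti)) ti
        ...   | yes tk with Extend.extension (Fin.fromℕ< n<t) f
                            (λ i<k → below (subst (_ <_) (Fin.toℕ-fromℕ< n<t) i<k)) tk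
        ...     | f′ , below′ , at = f′ , all
          where
          all : ∀ {i} → toℕ i < suc n → IsTriangle (facet i) → Potential f′ (facet i)
          all {i} (s≤s i≤n) ti with toℕ i ℕ.≟ n
          ... | no i≢n = below′ (subst (toℕ i <_) (sym (Fin.toℕ-fromℕ< n<t)) (ℕ.≤∧≢⇒< i≤n i≢n)) ti
          ... | yes i≡n = subst (Potential f′ ∘ facet)
                            (sym (Fin.toℕ-injective (trans i≡n (sym (Fin.toℕ-fromℕ< n<t))))) at

      potential : ∃[ f ] (∀ {x y z} → T x y z → φ x y ≡ f x ⊕ f y)
      potential with stage t
      ... | f , all = f , on
        where
        on : ∀ {x y z} → T x y z → φ x y ≡ f x ⊕ f y
        on {x} {y} {z} t with k , eq ← complete (triangle-facet t) =
          subst (Potential f) eq (all (Fin.toℕ<n k) (x , y , z , t , eq)) x y ∈tri₁ (∈tri₂ {x = x}) (T⇒≢ t)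

    order⇒locally : Locally (Face K)
    order⇒locally = acyclic , order⇒triangles-connected , order⇒link-connected , order⇒edges-connected
      where
      acyclic : Acyclic (Face K)
      acyclic Φ cocycle with f , eq ← Potential.potential (λ x y → lookup Φ (combine x y)) (cocycle _ _ _) =
        tabulate f , λ x y z t → trans (eq t) (sym (cong₂ _⊕_ (Vec.lookup∘tabulate f x) (Vec.lookup∘tabulate f y)))

-- Vertex sets given by lists

∣p∪q∣≤∣p∣+∣q∣ : ∀ {n} (p q : Subset n) → ∣ p ∪ q ∣ ≤ ∣ p ∣ + ∣ q ∣
∣p∪q∣≤∣p∣+∣q∣ [] [] = z≤n
∣p∪q∣≤∣p∣+∣q∣ (true ∷ p) (s ∷ q) =
  s≤s (ℕ.≤-trans (∣p∪q∣≤∣p∣+∣q∣ p q) (ℕ.+-monoʳ-≤ ∣ p ∣ (∣p∣≤∣x∷p∣ s q)))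
∣p∪q∣≤∣p∣+∣q∣ (false ∷ p) (true ∷ q) =
  ℕ.≤-trans (s≤s (∣p∪q∣≤∣p∣+∣q∣ p q)) (ℕ.≤-reflexive (sym (ℕ.+-suc ∣ p ∣ ∣ q ∣)))
∣p∪q∣≤∣p∣+∣q∣ (false ∷ p) (false ∷ q) = ∣p∪q∣≤∣p∣+∣q∣ p q

module _ {m : ℕ} where

  fromList : List (Fin m) → Subset m
  fromList = foldr (λ x S → ⁅ x ⁆ ∪ S) ⊥

  ∈-fromList⁺ : ∀ {x xs} → x ∈ˡ xs → x ∈ fromList xs
  ∈-fromList⁺ (here refl)          = x∈p∪q⁺ (inj₁ (x∈⁅x⁆ _))
  ∈-fromList⁺ {xs = y ∷ _} (there x∈) = x∈p∪q⁺ {p = ⁅ y ⁆} (inj₂ (∈-fromList⁺ x∈))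

  ∈-fromList⁻ : ∀ {x} xs → x ∈ fromList xs → x ∈ˡ xs
  ∈-fromList⁻ [] x∈ = contradiction x∈ ∉⊥
  ∈-fromList⁻ (y ∷ xs) x∈ with x∈p∪q⁻ ⁅ y ⁆ (fromList xs) x∈
  ... | inj₁ x∈y = here (x∈⁅y⁆⇒x≡y y x∈y)
  ... | inj₂ x∈xs = there (∈-fromList⁻ xs x∈xs)

  ∣⁅x⁆∪p∣≤1+∣p∣ : ∀ x (p : Subset m) → ∣ ⁅ x ⁆ ∪ p ∣ ≤ suc ∣ p ∣
  ∣⁅x⁆∪p∣≤1+∣p∣ x p = ℕ.≤-trans (∣p∪q∣≤∣p∣+∣q∣ ⁅ x ⁆ p) (ℕ.≤-reflexive (cong (_+ ∣ p ∣) (∣⁅x⁆∣≡1 x)))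

  ∣fromList∣≤ : ∀ xs → ∣ fromList xs ∣ ≤ length xs
  ∣fromList∣≤ [] = ℕ.≤-reflexive (∣⊥∣≡0 m)
  ∣fromList∣≤ (x ∷ xs) = ℕ.≤-trans (∣⁅x⁆∪p∣≤1+∣p∣ x (fromList xs)) (s≤s (∣fromList∣≤ xs))

  fresh : ∀ xs {F : Subset m} → length xs < ∣ F ∣ → ∃[ z ] z ∈ F × All (z ≢_) xs
  fresh xs {F} <∣F∣ with Fin.any? (λ z → z ∈? F ×-dec All.all? (λ x → ¬? (z Fin.≟ x)) xs)
  ... | yes found = found
  ... | no none = contradiction (ℕ.≤-trans <∣F∣ (ℕ.≤-trans (p⊆q⇒∣p∣≤∣q∣ F⊆) (∣fromList∣≤ xs))) (ℕ.<-irrefl refl)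
    where
    F⊆ : F ⊆ fromList xs
    F⊆ {z} z∈ with Any.any? (z Fin.≟_) xs
    ... | yes z∈xs = ∈-fromList⁺ z∈xs
    ... | no z∉xs  = contradiction (z , z∈ , ¬Any⇒All¬ xs z∉xs) none

  lookup-∈ : ∀ {x} {S : Subset m} → x ∈ S → lookup S x ≡ true
  lookup-∈ = Vec.[]=⇒lookup

  ∈-lookup′ : ∀ {x} {S : Subset m} → lookup S x ≡ true → x ∈ S
  ∈-lookup′ = Vec.lookup⇒[]= _ _

-- From small subcomplexes to a shelling

SmallSubcomplexesLocal : ∀ {m} → SimplicialComplex m → Set
SmallSubcomplexesLocal K = ∀ {U} (U⊆V : U ⊆ vertices K) → 4 ≤ ∣ U ∣ → ∣ U ∣ ≤ 7 → Locally (Face (induced K U U⊆V))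

module _ {m : ℕ} (K : SimplicialComplex m) (∣F∣≤3 : ∀ {F} → Face K F → ∣ F ∣ ≤ 3)
         (locally : SmallSubcomplexesLocal K) where

  module Restricted (W : Subset m) (W⊆V : W ⊆ vertices K) where

    K∣W : SimplicialComplex m
    K∣W = induced K W W⊆V

    system : TripleSystem (Fin m)
    system = triangles K∣W (∣F∣≤3 ∘ proj₁)

    open TripleSystem system
    open Triangles system

    module Small {a b c d us} (four : Unique (a ∷ b ∷ c ∷ d ∷ [])) (∣us∣≤3 : length us ≤ 3)
                 (us⊆W : All (_∈ W) (a ∷ b ∷ c ∷ d ∷ us)) where
      list : List (Fin m)
      list = a ∷ b ∷ c ∷ d ∷ us

      U : Subset m
      U = fromList list

      U⊆W : U ⊆ W
      U⊆W x∈ = All.lookup us⊆W (∈-fromList⁻ list x∈)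

      U⊆V : U ⊆ vertices K
      U⊆V x∈ = W⊆V (U⊆W x∈)

      local-U : Locally (Face (induced K U U⊆V))
      local-U = locally U⊆V
        (unique⇒≤∣∣ four (∈-fromList⁺ {xs = list} 0th ∷ ∈-fromList⁺ {xs = list} 1st ∷
                          ∈-fromList⁺ {xs = list} 2nd ∷ ∈-fromList⁺ {xs = list} 3rd ∷ []))
        (ℕ.≤-trans (∣fromList∣≤ list) (s≤s (s≤s (s≤s (s≤s ∣us∣≤3)))))

      Tᵁ : Fin m → Fin m → Fin m → Set
      Tᵁ = Triangle (Face (induced K U U⊆V))

      Tᵁ? : ∀ x y z → Dec (Tᵁ x y z)
      Tᵁ? = Triangle? _ (face? (induced K U U⊆V))

      Tᵁ⇒T : ∀ {x y z} → Tᵁ x y z → T x y z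
      Tᵁ⇒T (x≢y , y≢z , x≢z , F , F⊆U) = x≢y , y≢z , x≢z , F , λ x∈ → U⊆W (F⊆U x∈)

      Tᵁ⇒∈ : ∀ {x y z} → Tᵁ x y z → x ∈ˡ list × y ∈ˡ list × z ∈ˡ list
      Tᵁ⇒∈ {x} {y} (_ , _ , _ , _ , F⊆U) =
        ∈-fromList⁻ list (F⊆U ∈tri₁) , ∈-fromList⁻ list (F⊆U (∈tri₂ {x = x})) , ∈-fromList⁻ list (F⊆U (∈tri₃ {x = x} {y = y}))

      T⇒Tᵁ : ∀ {x y z} → T x y z → x ∈ˡ list → y ∈ˡ list → z ∈ˡ list → Tᵁ x y z
      T⇒Tᵁ (x≢y , y≢z , x≢z , F , _) x∈ y∈ z∈ =
        x≢y , y≢z , x≢z , F , tri-⊆ (∈-fromList⁺ x∈) (∈-fromList⁺ y∈) (∈-fromList⁺ z∈)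

    ∈W : ∀ {a b c} → T a b c → a ∈ W × b ∈ W × c ∈ W
    ∈W {a} {b} (_ , _ , _ , _ , F⊆W) = F⊆W ∈tri₁ , F⊆W (∈tri₂ {x = a}) , F⊆W (∈tri₃ {x = a} {y = b})

    half : ∀ {a b c d e f p q r} → T p q r → p ∈[ a , b , c ] → q ∈[ a , b , c ] → r ∈[ d , e , f ] → Half a b c d e f
    half {a} {b} {c} t p∈ q∈ r∈ = place (split t p∈ q∈) r∈
      where
      split : ∀ {p q r} → T p q r → p ∈[ a , b , c ] → q ∈[ a , b , c ] → Split a b c r
      split t (inj₁ refl)        (inj₁ refl)        = contradiction refl (T⇒≢ t)
      split t (inj₁ refl)        (inj₂ (inj₁ refl)) = inj₁ t
      split t (inj₁ refl)        (inj₂ (inj₂ refl)) = inj₂ (inj₁ t)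
      split t (inj₂ (inj₁ refl)) (inj₁ refl)        = inj₁ (T-swap t)
      split t (inj₂ (inj₁ refl)) (inj₂ (inj₁ refl)) = contradiction refl (T⇒≢ t)
      split t (inj₂ (inj₁ refl)) (inj₂ (inj₂ refl)) = inj₂ (inj₂ t)
      split t (inj₂ (inj₂ refl)) (inj₁ refl)        = inj₂ (inj₁ (T-swap t))
      split t (inj₂ (inj₂ refl)) (inj₂ (inj₁ refl)) = inj₂ (inj₂ (T-swap t))
      split t (inj₂ (inj₂ refl)) (inj₂ (inj₂ refl)) = contradiction refl (T⇒≢ t)
      place : ∀ {d e f r} → Split a b c r → r ∈[ d , e , f ] → Half a b c d e f
      place s (inj₁ refl)        = inj₁ s
      place s (inj₂ (inj₁ refl)) = inj₂ (inj₁ s)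
      place s (inj₂ (inj₂ refl)) = inj₂ (inj₂ s)

    -- If no triangle on the six vertices left `tri a b c`, this set would separate the two given
    -- triangles, against connectedness. The third vertex of a triangle that leaves it decides which
    -- of the two contributes two vertices.
    crossing : ∀ {a b c d e f} → T a b c → T d e f → Cross a b c d e f
    crossing {a} {b} {c} {d} {e} {f} abc def with Fin.any? (λ u → u ∈? tri a b c ×-dec u ∈? tri d e f)
    ... | yes (u , u∈ , u∈′) = inj₁ (u , ∈tri⁻ u∈ , ∈tri⁻ u∈′)
    ... | no disjoint = inj₂ (search (Fin.any? λ x → Fin.any? λ y → Fin.any? λ z → Tᵁ? x y z ×-dec x ∈? S ×-dec ¬? (y ∈? S)))
      where
      S = tri a b c
      ∈S⇒≢d : ∀ {u} → u ∈[ a , b , c ] → u ≢ d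
      ∈S⇒≢d u∈ refl = disjoint (d , ∈tri⁺ u∈ , ∈tri₁)
      open Small {a} {b} {c} {d} {e ∷ f ∷ []}
        ((T⇒≢ abc ∷ T⇒≢ (T-rotate (T-rotate abc)) ∘ sym ∷ ∈S⇒≢d (inj₁ refl) ∷ []) ∷
         (T⇒≢ (T-rotate abc) ∷ ∈S⇒≢d (inj₂ (inj₁ refl)) ∷ []) ∷ (∈S⇒≢d (inj₂ (inj₂ refl)) ∷ []) ∷ [] ∷ [])
        (s≤s (s≤s z≤n))
        (proj₁ (∈W abc) ∷ proj₁ (proj₂ (∈W abc)) ∷ proj₂ (proj₂ (∈W abc)) ∷
         proj₁ (∈W def) ∷ proj₁ (proj₂ (∈W def)) ∷ proj₂ (proj₂ (∈W def)) ∷ [])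
      outer : ∀ {u} → u ∈ˡ list → u ∉ S → u ∈[ d , e , f ]
      outer 0th u∉ = contradiction ∈tri₁ u∉
      outer 1st u∉ = contradiction (∈tri₂ {x = a}) u∉
      outer 2nd u∉ = contradiction (∈tri₃ {x = a} {y = b}) u∉
      outer 3rd _  = inj₁ refl
      outer 4th _  = inj₂ (inj₁ refl)
      outer 5th _  = inj₂ (inj₂ refl)
      search : Dec (∃[ x ] ∃[ y ] ∃[ z ] Tᵁ x y z × x ∈ S × y ∉ S) → Half a b c d e f ⊎ Half d e f a b c
      search (yes (x , y , z , t , x∈ , y∉)) with z ∈? S | Tᵁ⇒∈ t
      ... | yes z∈ | _ , y∈ , _  = inj₁ (half (T-rotate (T-rotate (Tᵁ⇒T t))) (∈tri⁻ z∈) (∈tri⁻ x∈) (outer y∈ y∉))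
      ... | no z∉  | _ , y∈ , z∈ = inj₂ (half (T-rotate (Tᵁ⇒T t)) (outer y∈ y∉) (outer z∈ z∉) (∈tri⁻ x∈))
      search (no none) = contradiction (∈-lookup′ (trans (sym same) (lookup-∈ {S = S} ∈tri₁)))
                                     (λ d∈S → disjoint (d , d∈S , ∈tri₁))
        where
        inside-stays : ∀ {x y z} → Tᵁ x y z → x ∈ S → y ∈ S
        inside-stays {x} {y} {z} t x∈ = decidable-stable (y ∈? S) λ y∉ → none (x , y , z , t , x∈ , y∉)
        stays : ∀ x y → ∃ (Tᵁ x y) → lookup S x ≡ lookup S y
        stays x y (z , t@(x≢y , y≢z , x≢z , F , F⊆U)) with x ∈? S | y ∈? S
        ... | yes x∈ | _      = trans (lookup-∈ x∈) (sym (lookup-∈ (inside-stays t x∈)))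
        ... | _      | yes y∈ = trans (lookup-∈ (inside-stays (T-swapᵁ t) y∈)) (sym (lookup-∈ y∈))
          where
          T-swapᵁ : ∀ {x y z} → Tᵁ x y z → Tᵁ y x z
          T-swapᵁ t = let x∈ , y∈ , z∈ = Tᵁ⇒∈ t in T⇒Tᵁ (T-swap (Tᵁ⇒T t)) y∈ x∈ z∈
        ... | no x∉  | no y∉  = trans (Bool.¬-not (x∉ ∘ ∈-lookup′)) (sym (Bool.¬-not (y∉ ∘ ∈-lookup′)))
        same : lookup S a ≡ lookup S d
        same = proj₁ (proj₂ local-U) S stays a b d e
                 (c , T⇒Tᵁ abc 0th 1st 2nd) (f , T⇒Tᵁ def 3rd 4th 5th)

    -- With no joining edge, the set of `a` and `b` would be closed in the link of `v` within the
    -- five given vertices.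
    linked : ∀ {v a b c d} → T v a b → T v c d → Link v a b c d
    linked {v} {a} {b} {c} {d} vab vcd with a Fin.≟ c | a Fin.≟ d | b Fin.≟ c | b Fin.≟ d
    ... | yes a≡c | _ | _ | _ = inj₁ (inj₁ a≡c)
    ... | no _ | yes a≡d | _ | _ = inj₁ (inj₂ (inj₁ a≡d))
    ... | no _ | no _ | yes b≡c | _ = inj₁ (inj₂ (inj₂ (inj₁ b≡c)))
    ... | no _ | no _ | no _ | yes b≡d = inj₁ (inj₂ (inj₂ (inj₂ b≡d)))
    ... | no a≢c | no a≢d | no b≢c | no b≢d = inj₂ (search
          (T? v a c) (T? v a d) (T? v b c) (T? v b d))
      where
      open Small {v} {a} {b} {c} {d ∷ []}
        ((T⇒≢ vab ∷ T⇒≢ (T-rotate (T-rotate vab)) ∘ sym ∷ T⇒≢ vcd ∷ []) ∷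
         (T⇒≢ (T-rotate vab) ∷ a≢c ∷ []) ∷ (b≢c ∷ []) ∷ [] ∷ [])
        (s≤s z≤n)
        (proj₁ (∈W vab) ∷ proj₁ (proj₂ (∈W vab)) ∷ proj₂ (proj₂ (∈W vab)) ∷
         proj₁ (proj₂ (∈W vcd)) ∷ proj₂ (proj₂ (∈W vcd)) ∷ [])
      S = ⁅ a ⁆ ∪ ⁅ b ⁆
      search : Dec (T v a c) → Dec (T v a d) → Dec (T v b c) → Dec (T v b d) → T v a c ⊎ T v a d ⊎ T v b c ⊎ T v b d
      search (yes t) _ _ _ = inj₁ t
      search (no _) (yes t) _ _ = inj₂ (inj₁ t)
      search (no _) (no _) (yes t) _ = inj₂ (inj₂ (inj₁ t))
      search (no _) (no _) (no _) (yes t) = inj₂ (inj₂ (inj₂ t))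
      search (no ¬ac) (no ¬ad) (no ¬bc) (no ¬bd) = contradiction (trans (sym at-a) (trans same at-c)) λ ()
        where
        at-a : lookup S a ≡ true
        at-a = lookup-∈ {S = S} (x∈p∪q⁺ (inj₁ (x∈⁅x⁆ a)))
        at-b : lookup S b ≡ true
        at-b = lookup-∈ {S = S} (x∈p∪q⁺ {p = ⁅ a ⁆} (inj₂ (x∈⁅x⁆ b)))
        outside-S : ∀ {u} → u ≢ a → u ≢ b → lookup S u ≡ false
        outside-S {u} u≢a u≢b = Bool.¬-not λ eq → absurd (x∈p∪q⁻ ⁅ a ⁆ ⁅ b ⁆ (∈-lookup′ {S = S} eq))
          where
          absurd : ¬ (u ∈ ⁅ a ⁆ ⊎ u ∈ ⁅ b ⁆)
          absurd (inj₁ u∈) = u≢a (x∈⁅y⁆⇒x≡y a u∈)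
          absurd (inj₂ u∈) = u≢b (x∈⁅y⁆⇒x≡y b u∈)
        at-c : lookup S c ≡ false
        at-c = outside-S (a≢c ∘ sym) (b≢c ∘ sym)
        at-d : lookup S d ≡ false
        at-d = outside-S (a≢d ∘ sym) (b≢d ∘ sym)
        flip : ∀ {x y z} → T x y z → T x z y
        flip t = T-swap (T-rotate (T-rotate t))
        stays : ∀ x y → Tᵁ v x y → lookup S x ≡ lookup S y
        stays x y t with proj₂ (Tᵁ⇒∈ t) | Tᵁ⇒T t
        ... | 0th , _   | t = contradiction refl (T⇒≢ t)
        ... | _   , 0th | t = contradiction refl (T⇒≢ (flip t))
        ... | 1st , 1st | t = refl
        ... | 1st , 2nd | t = trans at-a (sym at-b)
        ... | 1st , 3rd | t = contradiction t ¬ac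
        ... | 1st , 4th | t = contradiction t ¬ad
        ... | 2nd , 1st | t = trans at-b (sym at-a)
        ... | 2nd , 2nd | t = refl
        ... | 2nd , 3rd | t = contradiction t ¬bc
        ... | 2nd , 4th | t = contradiction t ¬bd
        ... | 3rd , 1st | t = contradiction (flip t) ¬ac
        ... | 3rd , 2nd | t = contradiction (flip t) ¬bc
        ... | 3rd , 3rd | t = refl
        ... | 3rd , 4th | t = trans at-c (sym at-d)
        ... | 4th , 1st | t = contradiction (flip t) ¬ad
        ... | 4th , 2nd | t = contradiction (flip t) ¬bd
        ... | 4th , 3rd | t = trans at-d (sym at-c)
        ... | 4th , 4th | t = refl
        same : lookup S a ≡ lookup S c
        same = proj₁ (proj₂ (proj₂ local-U)) v S stays a b c d (T⇒Tᵁ vab 0th 1st 2nd) (T⇒Tᵁ vcd 0th 3rd 4th)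

    hereditary : Hereditary system
    hereditary = record { cross = crossing ; link = linked ; local = local }
      where
      local : ∀ φ → Cocycle T φ → ∀ {a b c d us} → Unique (a ∷ b ∷ c ∷ d ∷ []) → length us ≤ 3 →
              All (λ u → ∃ (E u)) (a ∷ b ∷ c ∷ d ∷ us) →
              Σ[ f ∈ (Fin m → Bool) ] (∀ {x y z} → Within (a ∷ b ∷ c ∷ d ∷ us) x y z → φ x y ≡ f x ⊕ f y)
      local φ cocycle four ∣us∣≤3 us-in =
        let f , eq = proj₁ local-U Φ Φ-cocycle
        in lookup f , λ (x∈ , y∈ , z∈ , t) → trans (sym (lookup-Φ _ _)) (eq _ _ _ (T⇒Tᵁ t x∈ y∈ z∈))
        where
        open Small four ∣us∣≤3 (All.map (λ (_ , _ , t) → proj₁ (∈W t)) us-in)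
        Φ : Subset (m * m)
        Φ = tabulate (uncurry φ ∘ remQuot m)
        lookup-Φ : ∀ x y → lookup Φ (combine x y) ≡ φ x y
        lookup-Φ x y = trans (Vec.lookup∘tabulate _ (combine x y)) (cong (uncurry φ) (Fin.remQuot-combine x y))
        Φ-cocycle : ∀ x y z → Tᵁ x y z →
                    lookup Φ (combine x y) ⊕ lookup Φ (combine y z) ≡ lookup Φ (combine x z)
        Φ-cocycle x y z t = trans (cong₂ _⊕_ (lookup-Φ x y) (lookup-Φ y z))
                              (trans (cocycle (Tᵁ⇒T t)) (sym (lookup-Φ x z)))

  -- The hypothesis covers small subcomplexes of all of `K`, so it holds for every `W` and permits
  -- induction by deleting one vertex.
  shellable-triangles : ∀ n W (W⊆V : W ⊆ vertices K) → ∣ W ∣ ≤ n →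
                        Triangles.ShellableTriangles (Restricted.system W W⊆V)
  shellable-triangles n W W⊆V ∣W∣≤n with nonempty? W | n
  ... | no empty | _ = [] , [] , (λ ()) , λ (_ , _ , _ , _ , F⊆W) → contradiction (_ , F⊆W ∈tri₁) empty
  ... | yes (v , v∈W) | zero = contradiction (ℕ.≤-<-trans z≤n (x∈p⇒∣p-x∣<∣p∣ v∈W)) (ℕ.≤⇒≯ ∣W∣≤n)
  ... | yes (v , v∈W) | suc n
    with L , shelling , sound , complete ← shellable-triangles n (W - v) (λ x∈ → W⊆V (p─q⊆p W ⁅ v ⁆ x∈))
                                             (ℕ.≤-pred (ℕ.<-≤-trans (x∈p⇒∣p-x∣<∣p∣ v∈W) ∣W∣≤n)) =
      Star.star-shelling (Restricted.system W W⊆V) (Restricted.hereditary W W⊆V) v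
        (record { shelling = shelling ; sound = sound′ ; base = base }) avoids
    where
    open Triangles (Restricted.system W W⊆V)
    sound′ : ∀ {F} → F ∈ˡ L → IsTriangle F
    sound′ F∈L with x , y , z , (x≢y , y≢z , x≢z , F , F⊆W-v) , eq ← sound F∈L =
      x , y , z , (x≢y , y≢z , x≢z , F , λ x∈ → p─q⊆p W ⁅ v ⁆ (F⊆W-v x∈)) , eq
    base : ∀ {x y z} → TripleSystem.T (Restricted.system W W⊆V) x y z → v ∉ tri x y z → tri x y z ∈ˡ L
    base (x≢y , y≢z , x≢z , F , F⊆W) v∉ =
      complete (x≢y , y≢z , x≢z , F , λ x∈ → x∈p∧x≢y⇒x∈p-y (F⊆W x∈) λ { refl → v∉ x∈ })
    avoids : ∀ {F} → F ∈ˡ L → v ∉ F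
    -- Were `v` in `W - v`, removing it a second time would shrink the set, but it changes nothing.
    avoids F∈L v∈F with _ , _ , _ , (_ , _ , _ , _ , F⊆W-v) , refl ← sound F∈L =
      ℕ.<-irrefl refl (ℕ.<-≤-trans (x∈p⇒∣p-x∣<∣p∣ (F⊆W-v v∈F)) (p⊆q⇒∣p∣≤∣q∣ twice))
      where
      twice : W - v ⊆ W - v - v
      twice = ⊆-reflexive (sym (p─q─q≡p─q W ⁅ v ⁆))

  -- Appending the facets of dimension at most one

  module Remaining {a b c : Fin m} (abc : Triangle (Face K) a b c) where

    open TripleSystem (triangles K ∣F∣≤3)
    open Triangles (triangles K ∣F∣≤3)

    record Partial (L : List (Subset m)) : Set where
      field
        shelling : Shelling L
        sound    : ∀ {F} → F ∈ˡ L → IsFacet (Face K) F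
        base     : ∀ {x y z} → T x y z → tri x y z ∈ˡ L

    IsFacet? : ∀ F → Dec (IsFacet (Face K) F)
    IsFacet? F = face? K F ×-dec allSubset? λ G → face? K G →-dec F ⊆? G →-dec F ≟ˢ G

    module Progress {L : List (Subset m)} (partial : Partial L) where
      open Partial partial

      Step : Set
      Step = ∃[ F ] IsFacet (Face K) F × F ∉ˡ L × Partial (F ∷ L)

      Touched : Fin m → Set
      Touched x = ∃[ H ] H ∈ˡ L × x ∈ H

      touched? : ∀ x → Dec (Touched x)
      touched? x = map′ (λ any → let _ , H∈L , x∈H = find any in _ , H∈L , x∈H)
                        (λ (_ , H∈L , x∈H) → lose H∈L x∈H) (Any.any? (x ∈?_) L)

      add : ∀ {F} → IsFacet (Face K) F → F ∉ˡ L → Attaches F L → Step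
      add facet F∉L att = _ , facet , F∉L , record
        { shelling = att ∷ shelling
        ; sound    = λ { (here refl) → facet ; (there F∈L) → sound F∈L }
        ; base     = there ∘ base
        }

      ⊈ : ∀ {F G} → IsFacet (Face K) F → F ∉ˡ L → G ∈ˡ L → ¬ F ⊆ G
      ⊈ facet F∉L G∈L F⊆G = F∉L (subst (_∈ˡ L) (sym (proj₂ facet _ (proj₁ (sound G∈L)) F⊆G)) G∈L)

      -- A third vertex would make `F` a triangle, which is already listed. As `H` contains `x`, it
      -- covers the intersection with every `G` that misses `y`; a `G` containing `y` misses `x` and
      -- covers its own.
      add-edge : ∀ {F x y} → IsFacet (Face K) F → F ∉ˡ L → x ∈ F → y ∈ F → x ≢ y → Touched x → Step
      add-edge {F} {x} {y} facet F∉L x∈F y∈F x≢y (H , H∈L , x∈H) = add facet F∉L att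
        where
        pair : ∀ {u} → u ∈ F → u ≡ x ⊎ u ≡ y
        pair {u} u∈F with u Fin.≟ x | u Fin.≟ y
        ... | yes u≡x | _       = inj₁ u≡x
        ... | no _    | yes u≡y = inj₂ u≡y
        ... | no u≢x  | no u≢y  with t , refl ← face⇒triangle K ∣F∣≤3 (proj₁ facet) x∈F y∈F u∈F x≢y (u≢y ∘ sym) (u≢x ∘ sym) =
          contradiction (base t) F∉L
        both : ∀ {G} → x ∈ G → y ∈ G → F ⊆ G
        both x∈G y∈G u∈F with pair u∈F
        ... | inj₁ refl = x∈G
        ... | inj₂ refl = y∈G
        att : Attaches F L
        att {G} G∈L with x ∈? G | y ∈? G
        ... | yes x∈G | yes y∈G = contradiction {A = F ⊆ G} (both x∈G y∈G) (⊈ facet F∉L G∈L)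
        ... | no x∉G  | yes y∈G = G , G∈L , (λ _ u∈G → u∈G) , x , x∈F , x∉G ,
          λ u∈F u≢x → case-pair (pair u∈F) u≢x y∈G
          where
          case-pair : ∀ {u} → u ≡ x ⊎ u ≡ y → u ≢ x → y ∈ G → u ∈ G
          case-pair (inj₁ u≡x) u≢x _ = contradiction u≡x u≢x
          case-pair (inj₂ refl) _ y∈G = y∈G
        ... | _       | no y∉G  = H , H∈L , (λ u∈F u∈G → side (pair u∈F) (λ { refl → y∉G u∈G })) ,
          y , y∈F , (λ y∈H → ⊈ facet F∉L H∈L (both x∈H y∈H)) , λ u∈F u≢y → side (pair u∈F) u≢y
          where
          side : ∀ {u} → u ≡ x ⊎ u ≡ y → u ≢ y → u ∈ H
          side (inj₁ refl) _  = x∈H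
          side (inj₂ u≡y) u≢y = contradiction u≡y u≢y

      abc∈L : tri a b c ∈ˡ L
      abc∈L = base abc

      -- Some edge joins abc to an edge xy that is disjoint from it; its facet can be added before that of xy.
      add-bridge : ∀ {x y} → Edge (Face K) x y → ¬ Touched x → ¬ Touched y → Step
      add-bridge {x} {y} xy ¬x ¬y with Fin.any? (λ p → Fin.any? (λ q → Edge? _ (face? K) p q ×-dec touched? p ×-dec ¬? (touched? q)))
      ... | yes (p , q , (p≢q , pq) , tp , ¬tq) with F , facet , pq⊆F ← facet-above (face? K) pq =
        add-edge facet (λ F∈L → ¬tq (F , F∈L , pq⊆F (q⊆p∪q ⁅ p ⁆ ⁅ q ⁆ (x∈⁅x⁆ q))))
          (pq⊆F (p⊆p∪q ⁅ q ⁆ (x∈⁅x⁆ p))) (pq⊆F (q⊆p∪q ⁅ p ⁆ ⁅ q ⁆ (x∈⁅x⁆ q))) p≢q tp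
      -- Now touchedness is constant along every edge of `K`, so it separates `ab` from `xy` in the
      -- induced subcomplex on these four vertices.
      ... | no none = contradiction (trans (sym at-a) (trans same at-x)) λ ()
        where
        ta : Touched a
        ta = _ , abc∈L , ∈tri₁
        tb : Touched b
        tb = _ , abc∈L , ∈tri₂ {x = a}
        ab∈K : Face K (⁅ a ⁆ ∪ ⁅ b ⁆)
        ab∈K = ⊆-closed K (pair-⊆ {y = b} ∈tri₁ (∈tri₂ {x = a})) (proj₂ (proj₂ (proj₂ abc)))
        list : List (Fin m)
        list = a ∷ b ∷ x ∷ y ∷ []
        U : Subset m
        U = fromList list
        ≢ : ∀ {p q} → Touched p → ¬ Touched q → p ≢ q
        ≢ tp ¬tq refl = ¬tq tp
        U⊆V : U ⊆ vertices K
        U⊆V u∈ with ∈-fromList⁻ list u∈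
        ... | 0th = face⊆vertices K ab∈K (p⊆p∪q ⁅ b ⁆ (x∈⁅x⁆ a))
        ... | 1st = face⊆vertices K ab∈K (q⊆p∪q ⁅ a ⁆ ⁅ b ⁆ (x∈⁅x⁆ b))
        ... | 2nd = face⊆vertices K (proj₂ xy) (p⊆p∪q ⁅ y ⁆ (x∈⁅x⁆ x))
        ... | 3rd = face⊆vertices K (proj₂ xy) (q⊆p∪q ⁅ x ⁆ ⁅ y ⁆ (x∈⁅x⁆ y))
        connected : Connected (Edge (Face (induced K U U⊆V)))
        connected = proj₂ (proj₂ (proj₂ (locally U⊆V
          (unique⇒≤∣∣ ((proj₁ abc ∷ ≢ ta ¬x ∷ ≢ ta ¬y ∷ []) ∷ (≢ tb ¬x ∷ ≢ tb ¬y ∷ []) ∷ (proj₁ xy ∷ []) ∷ [] ∷ [])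
            (∈-fromList⁺ {xs = list} 0th ∷ ∈-fromList⁺ {xs = list} 1st ∷
             ∈-fromList⁺ {xs = list} 2nd ∷ ∈-fromList⁺ {xs = list} 3rd ∷ []))
          (ℕ.≤-trans (∣fromList∣≤ list) (ℕ.m≤m+n 4 3)))))
        S : Subset m
        S = tabulate (does ∘ touched?)
        at : ∀ u → lookup S u ≡ does (touched? u)
        at = Vec.lookup∘tabulate _
        at-a : lookup S a ≡ true
        at-a = trans (at a) (dec-true (touched? a) ta)
        at-x : lookup S x ≡ false
        at-x = trans (at x) (dec-false (touched? x) ¬x)
        stays : ∀ p q → Edge (Face (induced K U U⊆V)) p q → lookup S p ≡ lookup S q
        stays p q (p≢q , pq , _) = trans (at p) (trans (cases (touched? p) (touched? q)) (sym (at q)))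
          where
          cases : (P : Dec (Touched p)) (Q : Dec (Touched q)) → does P ≡ does Q
          cases (yes _)  (yes _)  = refl
          cases (no _)   (no _)   = refl
          cases (yes tp) (no ¬tq) = contradiction (p , q , (p≢q , pq) , tp , ¬tq) none
          cases (no ¬tp) (yes tq) = contradiction (q , p , (p≢q ∘ sym , subst (Face K) (∪-comm ⁅ p ⁆ ⁅ q ⁆) pq) , tq , ¬tp) none
        same : lookup S a ≡ lookup S x
        same = connected S stays a b x y
          (proj₁ abc , ab∈K , pair-⊆ (∈-fromList⁺ {xs = list} 0th) (∈-fromList⁺ {xs = list} 1st))
          (proj₁ xy , proj₂ xy , pair-⊆ (∈-fromList⁺ {xs = list} 2nd) (∈-fromList⁺ {xs = list} 3rd))

      progress : ∃[ F ] IsFacet (Face K) F × F ∉ˡ L → Step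
      progress (F , facet , F∉L) with Fin.any? (λ x → Fin.any? (λ y → x ∈? F ×-dec y ∈? F ×-dec ¬? (x Fin.≟ y)))
      ... | yes (x , y , x∈F , y∈F , x≢y) with touched? x | touched? y
      ...   | yes tx | _      = add-edge facet F∉L x∈F y∈F x≢y tx
      ...   | no _   | yes ty = add-edge facet F∉L y∈F x∈F (x≢y ∘ sym) ty
      ...   | no ¬x  | no ¬y  = add-bridge (x≢y , ⊆-closed K (pair-⊆ x∈F y∈F) (proj₁ facet)) ¬x ¬y
      progress (F , facet , F∉L) | no none with nonempty? F
      ... | no empty = contradiction abc∈L (subst (_∉ˡ L)
              (proj₂ facet _ (proj₂ (proj₂ (proj₂ abc))) (λ u∈ → contradiction (_ , u∈) empty)) F∉L)
      -- A facet with a single vertex meets every other one in the empty face, which has the right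
      -- dimension.
      ... | yes (x , x∈F) = add facet F∉L λ {G} G∈L →
              G , G∈L , (λ _ u∈G → u∈G) , x , x∈F ,
              (λ x∈G → ⊈ facet F∉L G∈L λ u∈F → subst (_∈ G) (sym (only u∈F)) x∈G) ,
              λ u∈F u≢x → contradiction (only u∈F) u≢x
        where
        only : ∀ {u} → u ∈ F → u ≡ x
        only {u} u∈F = decidable-stable (u Fin.≟ x) λ u≢x → none (u , x , u∈F , x∈F , u≢x)

    facet-shelling : ∃[ L ] Shelling L × (∀ {F} → F ∈ˡ L → IsFacet (Face K) F) × (∀ {F} → IsFacet (Face K) F → F ∈ˡ L)
    facet-shelling =
      let L , shelling , sound , complete = shellable-triangles _ (vertices K) (λ x∈ → x∈) ℕ.≤-refl
          L′ , partial , all = greedy IsFacet? Progress.progress {L} record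
            { shelling = shelling
            ; sound    = λ F∈L → let x , y , z , (x≢y , y≢z , x≢z , F , _) , eq = sound F∈L in
                         subst (IsFacet (Face K)) (sym eq) (triangle-facet K ∣F∣≤3 (x≢y , y≢z , x≢z , F))
            ; base     = λ (x≢y , y≢z , x≢z , F) → complete (x≢y , y≢z , x≢z , F , face⊆vertices K F)
            }
      in L′ , Partial.shelling partial , Partial.sound partial , all

-- From a list to a shelling order

module _ {m : ℕ} where

  -- The newest facet heads the list, so a larger position means an earlier facet; `opposite` later
  -- restores the order of a shelling.
  lookup-ridge : ∀ {L : List (Subset m)} → Shelling L → ∀ {p q} → p Fin.< q →
    ∃[ r ] p Fin.< r × (∀ {x} → x ∈ List.lookup L p → x ∈ List.lookup L q → x ∈ List.lookup L r) ×
           Ridge (List.lookup L p) (List.lookup L r)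
  lookup-ridge {F ∷ L} (att ∷ _) {Fin.zero} {Fin.suc q} _
    with H , H∈L , meet , rdg ← att (∈-lookup {xs = L} q) =
      Fin.suc (Any.index H∈L) , s≤s z≤n ,
      subst (λ H → (∀ {x} → x ∈ F → x ∈ List.lookup L q → x ∈ H) × Ridge F H) (lookup-index H∈L) (meet , rdg)
  lookup-ridge {F ∷ L} (_ ∷ shelling) {Fin.suc p} {Fin.suc q} (s≤s p<q)
    with r , p<r , props ← lookup-ridge shelling p<q = Fin.suc r , s≤s p<r , props

  module _ {K : SimplicialComplex m} {L : List (Subset m)} (shelling : Shelling L)
           (sound : ∀ {F} → F ∈ˡ L → IsFacet (Face K) F) (complete : ∀ {F} → IsFacet (Face K) F → F ∈ˡ L) where

    private
      facet : Fin (length L) → Subset m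
      facet k = List.lookup L (opposite k)

      opposite-< : ∀ {n} {i k : Fin n} → i Fin.< k → opposite k Fin.< opposite i
      opposite-< {n} {i} {k} i<k rewrite Fin.opposite-prop i | Fin.opposite-prop k =
        ℕ.∸-monoʳ-< (s≤s i<k) (Fin.toℕ<n k)

      ridge : ∀ {i k} → i Fin.< k → ∃[ j ] j Fin.< k ×
              (∀ {x} → x ∈ facet k → x ∈ facet i → x ∈ facet j) × Ridge (facet k) (facet j)
      ridge {i} {k} i<k with r , k<r , props ← lookup-ridge shelling (opposite-< i<k) =
        opposite r , subst (opposite r Fin.<_) (Fin.opposite-involutive k) (opposite-< k<r) ,
        subst (λ r → (∀ {x} → x ∈ facet k → x ∈ facet i → x ∈ List.lookup L r) × Ridge (facet k) (List.lookup L r))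
              (sym (Fin.opposite-involutive r)) props

      distinct : ∀ {i k} → i Fin.< k → facet i ≢ facet k
      distinct i<k eq with _ , _ , meet , z , z∈k , z∉j , _ ← ridge i<k = z∉j (meet z∈k (subst (z ∈_) (sym eq) z∈k))

      injective : ∀ {i k} → facet i ≡ facet k → i ≡ k
      injective {i} {k} eq with Fin.<-cmp i k
      ... | tri< i<k _ _ = contradiction eq (distinct i<k)
      ... | tri≈ _ i≡k _ = i≡k
      ... | tri> _ _ k<i = contradiction (sym eq) (distinct k<i)

      𝓘 : Fin (length L) → Family m
      𝓘 k G = earlier facet k G × simplex (facet k) G

      ridge-size : ∀ {F G : Subset m} → Ridge F G → suc ∣ F ∩ G ∣ ≡ ∣ F ∣
      ridge-size {F} {G} (z , z∈F , z∉G , rest) = ℕ.≤-antisym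
        (p⊂q⇒∣p∣<∣q∣ (p∩q⊆p F G , z , z∈F , λ z∈ → z∉G (p∩q⊆q F G z∈)))
        (ℕ.≤-trans (p⊆q⇒∣p∣≤∣q∣ F⊆) (∣⁅x⁆∪p∣≤1+∣p∣ z (F ∩ G)))
        where
        F⊆ : F ⊆ ⁅ z ⁆ ∪ (F ∩ G)
        F⊆ {x} x∈F with x Fin.≟ z
        ... | yes refl = p⊆p∪q _ (x∈⁅x⁆ z)
        ... | no x≢z = q⊆p∪q ⁅ z ⁆ _ (x∈p∩q⁺ (x∈F , rest x∈F x≢z))

      -- Every face of the intersection extends to some `facet k ∩ facet j` of codimension one,
      -- which yields both purity and the dimension.
      cover : ∀ k {A} → 𝓘 k A → ∃[ B ] 𝓘 k B × A ⊆ B × dim B ≡ dim (facet k) ℤ.- 1ℤ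
      cover k ((i , i<k , A⊆i) , A⊆k) with j , j<k , meet , rdg ← ridge i<k =
        facet k ∩ facet j , ((j , j<k , p∩q⊆q (facet k) (facet j)) , p∩q⊆p (facet k) (facet j)) ,
        (λ x∈A → x∈p∩q⁺ (A⊆k x∈A , meet (A⊆k x∈A) (A⊆i x∈A))) , suc-dim {F = facet k ∩ facet j} {G = facet k} (ridge-size rdg)

      facet-dim : ∀ k {A} → IsFacet (𝓘 k) A → dim A ≡ dim (facet k) ℤ.- 1ℤ
      facet-dim k (A∈𝓘 , maximal) with B , B∈𝓘 , A⊆B , eq ← cover k A∈𝓘 = trans (cong dim (maximal B B∈𝓘 A⊆B)) eq

      first-earlier : ∀ {n} (k : Fin n) → 0 < toℕ k → Σ[ i ∈ Fin n ] i Fin.< k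
      first-earlier (Fin.suc k) _ = Fin.zero , s≤s z≤n

    shelling⇒shellable : Shellable K
    shelling⇒shellable = record
      { t         = length L
      ; facet     = facet
      ; injective = injective
      ; facets    = λ F → mk⇔
          (λ F-facet → opposite (Any.index (complete F-facet)) ,
            trans (cong (List.lookup L) (Fin.opposite-involutive _)) (sym (lookup-index (complete F-facet))))
          (λ { (k , refl) → sound (∈-lookup (opposite k)) })
      ; shelling  = λ k 0<k →
          (λ F G F-facet G-facet → trans (facet-dim k F-facet) (sym (facet-dim k G-facet))) ,
          (let i , i<k = first-earlier k 0<k
               B , B∈𝓘 , _ , eq = cover k {facet k ∩ facet i}
                 ((i , i<k , p∩q⊆q (facet k) (facet i)) , p∩q⊆p (facet k) (facet i))
           in B , B∈𝓘 , eq) ,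
          λ A A∈𝓘 → let B , _ , A⊆B , eq = cover k A∈𝓘 in
            ℤ.≤-trans (dim-mono A B (p⊆q⇒∣p∣≤∣q∣ A⊆B)) (ℤ.≤-reflexive eq)
      }

-- Dimension two and the search for a small obstruction

n-1≤2⇒n≤3 : ∀ n → + n ℤ.- 1ℤ ℤ.≤ + 2 → n ≤ 3
n-1≤2⇒n≤3 zero    _ = z≤n
n-1≤2⇒n≤3 (suc n) p = s≤s (ℤ.drop‿+≤+ p)

n-1≡2⇒n≡3 : ∀ n → + n ℤ.- 1ℤ ≡ + 2 → n ≡ 3
n-1≡2⇒n≡3 (suc n) eq = cong suc (ℤ.+-injective eq)

locally⇒shellable : ∀ {m} (K : SimplicialComplex m) → HasDimension (Face K) (+ 2) →
                    SmallSubcomplexesLocal K → Shellable K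
locally⇒shellable K ((F , F∈K , dimF) , bounded) locally = conclude (fresh [] (≤∣F∣ z≤n))
  where
  ∣F∣≤3 : ∀ {G} → Face K G → ∣ G ∣ ≤ 3
  ∣F∣≤3 {G} G∈K = n-1≤2⇒n≤3 ∣ G ∣ (bounded G G∈K)
  ≤∣F∣ : ∀ {n} → n ≤ 2 → n < ∣ F ∣
  ≤∣F∣ {n} n≤2 = subst (n <_) (sym (n-1≡2⇒n≡3 ∣ F ∣ dimF)) (s≤s n≤2)
  conclude : ∃[ x ] x ∈ F × All (x ≢_) [] → Shellable K
  conclude (x , x∈F , _)
    with y , y∈F , y≢x ∷ [] ← fresh (x ∷ []) (≤∣F∣ (s≤s z≤n))
    with z , z∈F , z≢x ∷ z≢y ∷ [] ← fresh (x ∷ y ∷ []) (≤∣F∣ (s≤s (s≤s z≤n)))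
    with t , _ ← face⇒triangle K ∣F∣≤3 F∈K x∈F y∈F z∈F (y≢x ∘ sym) (z≢y ∘ sym) (z≢x ∘ sym)
    with L , shelling , sound , complete ← Remaining.facet-shelling K ∣F∣≤3 locally t =
      shelling⇒shellable shelling sound complete

corollary4 : ∀ {m : ℕ} (K : SimplicialComplex m) → HasDimension (Face K) (+ 2) → ¬ Shellable K →
    ∃[ n ] (4 ≤ n × n ≤ 7 ×
    (∃[ U ] (Σ[ U⊆V ∈ U ⊆ vertices K ]
    (∣ vertices (induced K U U⊆V) ∣ ≡ n × ¬ Shellable (induced K U U⊆V)))))
-- The search is for a failure of `Locally`, which is decidable and rules out a shelling; if there
-- is none, `K` itself is shellable.
corollary4 K dimension ¬shellable with anySubset? bad?
  where
  Bad : Subset _ → Set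
  Bad U = Σ[ U⊆V ∈ U ⊆ vertices K ] 4 ≤ ∣ U ∣ × ∣ U ∣ ≤ 7 × ¬ Locally (Face (induced K U U⊆V))
  bad? : ∀ U → Dec (Bad U)
  bad? U with U ⊆? vertices K
  ... | no U⊈V  = no λ (U⊆V , _) → U⊈V U⊆V
  ... | yes U⊆V = map′ (U⊆V ,_) proj₂
    (4 ℕ.≤? ∣ U ∣ ×-dec ∣ U ∣ ℕ.≤? 7 ×-dec ¬? (Locally? _ (face? (induced K U U⊆V))))
... | yes (U , U⊆V , 4≤ , ≤7 , ¬locally) = ∣ U ∣ , 4≤ , ≤7 , U , U⊆V , refl , λ shellable →
  ¬locally (order⇒locally (induced K U U⊆V) (λ {F} (F∈K , _) → n-1≤2⇒n≤3 ∣ F ∣ (proj₂ dimension F F∈K))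
    (shellable⇒order shellable))
... | no none = contradiction (locally⇒shellable K dimension λ {U} U⊆V 4≤ ≤7 →
  decidable-stable (Locally? _ (face? (induced K U U⊆V))) λ ¬locally → none (U , U⊆V , 4≤ , ≤7 , ¬locally)) ¬shellable
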